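{- Let $K\subsetneq L$ be a field extension with at least one proper nontrivial intermediate field of finite $K$-dimension (i.e. a field $F$ with $K\subsetneq F\subsetneq L$ and $[F:K]<\infty$). For each integer $n$ with $n_0(K,L)\le n<[L:K]$, we have $$\Delta(n)=\max_{\substack{m\in \mathcal{M}(K,L)\\ m\le n}}\Bigl(m-1-\bigl(n \bmod m\bigr)\Bigr).$$
   Context: Fields are commutative. All dimensions are over $K$. $[n]=\{1,\dots,n\}$, and $\langle X\rangle$ denotes the $K$-span of a set $X$. The degree $[L:K]$ may be infinite, in which case $n<[L:K]$ holds for every integer $n$. $n \bmod m$ denotes the remainder $r$ with $0\le r<m$ of $n$ upon division by $m$. Definition (partial matching of bases). Let $A,B$ be $n$-dimensional $K$-subspaces of $L$, $n\ge 1$, and $0\le d\le n$ an integer. An ordered basis $\mathcal{A}=\{a_1,\dots,a_n\}$ of $A$ is partially matched to an ordered basis $\mathcal{B}=\{b_1,\dots,b_n\}$ of $B$ with defect $d$ if there exists $P\subseteq[n]$ with $|P|=n-d$ such that $$a_i^{ -1}A\cap B\subseteq \langle b_1,\dots,b_{i-1},b_{i+1},\dots,b_n\rangle\quad\text{for each } i\in P.$$ Definition (partial matching of subspaces). $A$ is partially matched to $B$ with defect $d$ if for every ordered basis $\mathcal{A}$ of $A$ there exists an ordered basis $\mathcal{B}$ of $B$ such that $\mathcal{A}$ is partially matched to $\mathcal{B}$ with defect $d$. Definition (deficiency). For $n$-dimensional $A,B$ with $0<n<\infty$ and $1\notin B$, $\delta(A,B)$ is the least nonnegative integer $d$ for which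 $A$ is partially matched to $B$ with defect $d$. Definition ($\mathcal{M}$, $n_0$, $\Delta$). $\mathcal{M}(K,L)$ is the set of all degrees $[F:K]$, where $F$ is a proper nontrivial intermediate field ($K\subsetneq F\subsetneq L$) of finite $K$-dimension. $n_0(K,L)$ is the smallest degree $[F:K]$ over all intermediate fields $K\subsetneq F\subseteq L$ with $[F:K]<\infty$; under the present hypotheses it equals $\min\mathcal{M}(K,L)$. For each integer $n$ with $n_0(K,L)\le n<[L:K]$, $$\Delta(n)=\max_{A,B}\delta(A,B),$$ where $A,B$ run over all pairs of $K$-subspaces of $L$ with $\dim A=\dim B=n$ and $1\notin B$. -}

module Defs where

open import Algebra.Apartness.Bundles using (HeytingField; HeytingCommutativeRing)
open import Algebra.Bundles using (CommutativeRing)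
import Algebra.Definitions.RawMonoid as RawMonoidDefs
open import Data.Fin.Base using (Fin)
open import Data.Fin.Subset as Subset using (Subset; ∣_∣)
open import Data.Nat.Base as ℕ using (ℕ; NonZero; _∸_; _%_)
open import Data.Product.Base using (Σ-syntax; ∃-syntax; _×_)
open import Data.Vec.Functional using (Vector)
open import Level using (Level; _⊔_; suc)
open import Relation.Binary.PropositionalEquality.Core using (_≡_; _≢_)
open import Relation.Nullary.Negation.Core using (¬_)
open import Relation.Unary using (Pred; _∈_; _∉_; _⊆_; _⊂_; _∩_; U)

private
  variable
    c ℓ₁ ℓ₂ p : Level

IsMinimum : Pred ℕ p → Pred ℕ p
IsMinimum X d = d ∈ X × (∀ {e} → e ∈ X → d ℕ.≤ e)

IsMaximum : Pred ℕ p → Pred ℕ p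
IsMaximum X d = d ∈ X × (∀ {e} → e ∈ X → e ℕ.≤ d)

-- The ambient field L is a HeytingField. Its apartness x # y is equivalent to
-- invertibility of x - y, and it is tight; so in the presence of excluded
-- middle # is just the negation of ≈, and L is an ordinary field.
-- Subsets of L are predicates on its carrier, taken at level c ⊔ ℓ₁, the level
-- at which K-spans live.

record Subfield (L : HeytingField c ℓ₁ ℓ₂) : Set (suc (c ⊔ ℓ₁)) where
  open HeytingField L using (Carrier; _≈_; _+_; _*_; -_; 0#; 1#)
  field
    carrier   : Pred Carrier (c ⊔ ℓ₁)
    resp-≈    : ∀ {x y} → x ≈ y → x ∈ carrier → y ∈ carrier
    0-closed  : 0# ∈ carrier
    1-closed  : 1# ∈ carrier
    +-closed  : ∀ {x y} → x ∈ carrier → y ∈ carrier → (x + y) ∈ carrier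
    -‿closed  : ∀ {x} → x ∈ carrier → (- x) ∈ carrier
    *-closed  : ∀ {x y} → x ∈ carrier → y ∈ carrier → (x * y) ∈ carrier
    ⁻¹-closed : ∀ {x y} → x ∈ carrier → (y * x) ≈ 1# → y ∈ carrier

module FieldExtension (L : HeytingField c ℓ₁ ℓ₂) (K : Subfield L) where

  open HeytingField L
    using (Carrier; _≈_; _+_; _*_; 0#; 1#; heytingCommutativeRing)
  open HeytingCommutativeRing heytingCommutativeRing using (commutativeRing)
  open CommutativeRing commutativeRing using (+-rawMonoid)
  open RawMonoidDefs +-rawMonoid using (sum)
  open Subfield using (carrier)

  Scalar : Pred Carrier (c ⊔ ℓ₁)
  Scalar = carrier K

  record Subspace : Set (suc (c ⊔ ℓ₁)) where
    field
      vectors  : Pred Carrier (c ⊔ ℓ₁)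
      resp-≈   : ∀ {x y} → x ≈ y → x ∈ vectors → y ∈ vectors
      0-closed : 0# ∈ vectors
      +-closed : ∀ {x y} → x ∈ vectors → y ∈ vectors → (x + y) ∈ vectors
      *-closed : ∀ {k x} → k ∈ Scalar → x ∈ vectors → (k * x) ∈ vectors

  open Subspace using (vectors)

  combination : ∀ {n} → Vector Carrier n → Vector Carrier n → Carrier
  combination k v = sum (λ i → k i * v i)

  ⟨_⟩ : Pred Carrier p → Pred Carrier (c ⊔ ℓ₁ ⊔ p)
  ⟨ X ⟩ x = ∃[ m ] Σ[ k ∈ Vector Carrier m ] Σ[ v ∈ Vector Carrier m ]
    (∀ i → k i ∈ Scalar) × (∀ i → v i ∈ X) × x ≈ combination k v

  Range : ∀ {n} → Vector Carrier n → Pred Carrier ℓ₁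
  Range v x = ∃[ i ] x ≈ v i

  Others : ∀ {n} → Vector Carrier n → Fin n → Pred Carrier ℓ₁
  Others v i x = ∃[ j ] j ≢ i × x ≈ v j

  LinearlyIndependent : ∀ {n} → Vector Carrier n → Set (c ⊔ ℓ₁)
  LinearlyIndependent {n} v = (k : Vector Carrier n) → (∀ i → k i ∈ Scalar) →
    combination k v ≈ 0# → ∀ i → k i ≈ 0#

  record IsOrderedBasis (W : Pred Carrier p) {n} (v : Vector Carrier n) :
                        Set (c ⊔ ℓ₁ ⊔ p) where
    field
      members     : ∀ i → v i ∈ W
      independent : LinearlyIndependent v
      spanning    : W ⊆ ⟨ Range v ⟩

  HasDimension : Pred Carrier p → ℕ → Set (c ⊔ ℓ₁ ⊔ p)
  HasDimension W n = Σ[ v ∈ Vector Carrier n ] IsOrderedBasis W v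

  -- a ⁻¹· A = { a⁻¹ y ∣ y ∈ A }. Inversion is not a total operation on L, so
  -- the (unique) inverse b of a is introduced by its defining equation.
  _⁻¹·_ : Carrier → Pred Carrier p → Pred Carrier (c ⊔ ℓ₁ ⊔ p)
  (a ⁻¹· A) x = ∃[ b ] (b * a) ≈ 1# × ∃[ y ] y ∈ A × x ≈ (b * y)

  BasisPartiallyMatched : ∀ {n} → Subspace → Subspace →
    Vector Carrier n → Vector Carrier n → ℕ → Set (c ⊔ ℓ₁)
  BasisPartiallyMatched {n} A B a b d =
    d ℕ.≤ n ×
    Σ[ P ∈ Subset n ] ∣ P ∣ ≡ n ∸ d ×
      (∀ i → i Subset.∈ P →
        ((a i ⁻¹· vectors A) ∩ vectors B) ⊆ ⟨ Others b i ⟩)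

  -- Here n is the common dimension of A and B.
  PartiallyMatched : ℕ → Subspace → Subspace → Pred ℕ (c ⊔ ℓ₁)
  PartiallyMatched n A B d =
    (a : Vector Carrier n) → IsOrderedBasis (vectors A) a →
    Σ[ b ∈ Vector Carrier n ]
      IsOrderedBasis (vectors B) b × BasisPartiallyMatched A B a b d

  -- IsDeficiency n A B d says δ(A,B) = d.
  IsDeficiency : ℕ → Subspace → Subspace → Pred ℕ (c ⊔ ℓ₁)
  IsDeficiency n A B = IsMinimum (PartiallyMatched n A B)

  DeficiencyAttained : ℕ → Pred ℕ (suc (c ⊔ ℓ₁))
  DeficiencyAttained n d = Σ[ A ∈ Subspace ] Σ[ B ∈ Subspace ]
    HasDimension (vectors A) n × HasDimension (vectors B) n ×
    1# ∉ vectors B × IsDeficiency n A B d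

  -- IsΔ n d says Δ(n) = d.
  IsΔ : ℕ → Pred ℕ (suc (c ⊔ ℓ₁))
  IsΔ n = IsMaximum (DeficiencyAttained n)

  ProperExtension : Set (c ⊔ ℓ₁)
  ProperExtension = Scalar ⊂ U

  -- The set of degrees [F : K] of finite extensions F with K ⊊ F ⊊ L.
  ℳ : Pred ℕ (suc (c ⊔ ℓ₁))
  ℳ m = Σ[ F ∈ Subfield L ]
    Scalar ⊂ carrier F × carrier F ⊂ U × HasDimension (carrier F) m

  -- Unlike in ℳ, F = L is allowed.
  IsN₀ : Pred ℕ (suc (c ⊔ ℓ₁))
  IsN₀ = IsMinimum λ d → Σ[ F ∈ Subfield L ]
    Scalar ⊂ carrier F × HasDimension (carrier F) d

  -- n < [L : K]; vacuously true when [L : K] is infinite.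
  _<[L:K] : ℕ → Set (c ⊔ ℓ₁)
  n <[L:K] = ∀ {m} → HasDimension U m → n ℕ.< m

  -- The values m - 1 - (n mod m) for m ∈ ℳ, m ≤ n. Truncated subtraction is
  -- exact because n mod m ≤ m - 1, and every m ∈ ℳ is nonzero.
  DegreeDefect : ℕ → Pred ℕ (suc (c ⊔ ℓ₁))
  DegreeDefect n d = ∃[ m ] m ∈ ℳ × m ℕ.≤ n ×
    Σ[ nz ∈ NonZero m ] d ≡ m ∸ 1 ∸ _%_ n m {{nz}}

{-# OPTIONS --safe #-}

-- Put U_i = a_i⁻¹A ∩ B. A basis of B to which a_1, …, a_n is matched with defect
-- d amounts to n - d independent functionals on B vanishing on the respective
-- U_i, so by Rado's theorem it exists once dim ⋂_{i ∈ J} U_i ≤ n - |J| + d for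
-- every J. With S = ⟨a_i : i ∈ J⟩ and T = K ⊕ ⋂_{i ∈ J} U_i one has S T ⊆ A, and
-- the bound to prove is dim S + dim T ≤ n + 1 + d. The Dyson e-transform reduces
-- it to the case S T ⊆ S, where T lies in the stabiliser H of S: if H has degree
-- m then m divides dim S ≤ n and dim T ≤ m, so dim S + dim T is at most
-- m⌊n/m⌋ + m = n + 1 + (m - 1 - n mod m).
--
-- Conversely, let F have degree m ≤ n and let A contain an F-subspace S of
-- dimension m⌊n/m⌋ and B a complement V of K in F. As S V ⊆ A, a basis of A
-- extending one of S can only be matched with a defect of at least
-- dim S + dim V - n = m - 1 - n mod m.
module Submission where

open import Defs
open import Algebra.Apartness.Bundles using (HeytingField; HeytingCommutativeRing)
open import Algebra.Bundles using (CommutativeRing)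
import Algebra.Properties.CommutativeSemigroup as CommutativeSemigroupProperties
import Algebra.Properties.Ring as RingProperties
open import Axiom.ExcludedMiddle using (ExcludedMiddle)
open import Data.Fin.Base using (Fin; zero; suc)
import Data.Fin.Properties as Fin using (_≟_)
open import Data.Fin.Subset as Subset using (Subset; inside; outside; ∣_∣; ⊤; _∪_; _∩_; ∁; ⁅_⁆)
open import Data.Fin.Subset.Properties
open import Data.Nat.Base as ℕ using (ℕ; zero; suc; NonZero; _≤_; _<_; z≤n; s≤s; _∸_; _%_; _/_)
open import Data.Nat.DivMod using (m≡m%n+[m/n]*n; m/n*n≤m; /-monoˡ-≤; m*n/n≡m)
open import Data.Nat.Properties as ℕₚ using (≤-refl; ≤-trans; ≤-reflexive)
open import Data.Nat.Solver using (module +-*-Solver)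
open import Data.Product.Base using (Σ-syntax; ∃-syntax; _×_; _,_; proj₁; proj₂)
open import Data.Sum.Base using (_⊎_; inj₁; inj₂)
open import Data.Unit.Polymorphic.Base using (tt) renaming (⊤ to Unit)
open import Data.Vec.Base using ([]; _∷_; here; there)
open import Data.Vec.Functional as Vector using (Vector; head; tail)
open import Data.Vec.Functional.Properties using (updateAt-updates; updateAt-minimal)
open import Function.Base using (id)
open import Level using (Lift; lift; lower; _⊔_) renaming (suc to lsuc)
open import Relation.Binary.PropositionalEquality as ≡ using (_≡_; _≢_)
import Relation.Binary.Reasoning.Setoid as SetoidReasoning
open import Relation.Nullary.Decidable using (Dec; yes; no; map′)
open import Relation.Nullary.Negation using (¬_; contradiction)
open import Relation.Unary using (Pred; _∈_; _∉_; _⊆_; _⊂_; U)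

-- Adjoining 1 to the common intersection raises its dimension because 1 lies outside B; this is the
-- 1 in n + 1 + d. It also gives S ⊆ S T ⊆ A, hence dim S ≤ n, and every e-transform keeps 1 in T.
-- The stabiliser H is known only when the transforms stop, so the bound is proved for the largest
-- defect over all admissible m at once. If H = K, no member of `ℳ` arises, but then dim T ≤ 1 and
-- dim S ≤ n suffice. H = L is excluded by dim H ≤ dim S ≤ n < [L : K]; the same inequality supplies
-- the vectors from which the extremal A and B are grown. No dual space is formed. A functional is
-- represented by its kernel, a subspace of codimension at most one, and Rado's theorem is proved by
-- enlarging each U_i to such a kernel without losing the rank condition. Dimension is the length of
-- a flag. The maximum exists because every defect is at most n and m = n_0 contributes one.

-- Sizes of subsets and arithmetic of remainders

∣p∪q∣+∣p∩q∣≡∣p∣+∣q∣ : ∀ {n} (p q : Subset n) → ∣ p ∪ q ∣ ℕ.+ ∣ p ∩ q ∣ ≡ ∣ p ∣ ℕ.+ ∣ q ∣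
∣p∪q∣+∣p∩q∣≡∣p∣+∣q∣ []            []            = ≡.refl
∣p∪q∣+∣p∩q∣≡∣p∣+∣q∣ (outside ∷ p) (outside ∷ q) = ∣p∪q∣+∣p∩q∣≡∣p∣+∣q∣ p q
∣p∪q∣+∣p∩q∣≡∣p∣+∣q∣ (inside  ∷ p) (outside ∷ q) = ≡.cong suc (∣p∪q∣+∣p∩q∣≡∣p∣+∣q∣ p q)
∣p∪q∣+∣p∩q∣≡∣p∣+∣q∣ (outside ∷ p) (inside  ∷ q) =
  ≡.trans (≡.cong suc (∣p∪q∣+∣p∩q∣≡∣p∣+∣q∣ p q)) (≡.sym (ℕₚ.+-suc ∣ p ∣ ∣ q ∣))
∣p∪q∣+∣p∩q∣≡∣p∣+∣q∣ (inside  ∷ p) (inside  ∷ q) = ≡.cong suc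
  (≡.trans (ℕₚ.+-suc ∣ p ∪ q ∣ ∣ p ∩ q ∣)
    (≡.trans (≡.cong suc (∣p∪q∣+∣p∩q∣≡∣p∣+∣q∣ p q)) (≡.sym (ℕₚ.+-suc ∣ p ∣ ∣ q ∣))))

∣p∣+∣q∣≤n+∣p∩q∣ : ∀ {n} (p q : Subset n) → ∣ p ∣ ℕ.+ ∣ q ∣ ≤ n ℕ.+ ∣ p ∩ q ∣
∣p∣+∣q∣≤n+∣p∩q∣ p q = ≤-trans (≤-reflexive (≡.sym (∣p∪q∣+∣p∩q∣≡∣p∣+∣q∣ p q)))
  (ℕₚ.+-monoˡ-≤ ∣ p ∩ q ∣ (∣p∣≤n (p ∪ q)))

∣p∣≤1+∣p∩∁⁅i⁆∣ : ∀ {n} (p : Subset n) i → ∣ p ∣ ≤ suc ∣ p ∩ ∁ ⁅ i ⁆ ∣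
∣p∣≤1+∣p∩∁⁅i⁆∣ {suc n} p i = ℕₚ.+-cancelʳ-≤ n _ _ (begin
  ∣ p ∣ ℕ.+ n                     ≡⟨ ≡.cong (∣ p ∣ ℕ.+_) ∣∁⁅i⁆∣≡n ⟨
  ∣ p ∣ ℕ.+ ∣ ∁ ⁅ i ⁆ ∣           ≤⟨ ∣p∣+∣q∣≤n+∣p∩q∣ p (∁ ⁅ i ⁆) ⟩
  suc n ℕ.+ ∣ p ∩ ∁ ⁅ i ⁆ ∣       ≡⟨ ≡.cong suc (ℕₚ.+-comm n _) ⟩
  suc ∣ p ∩ ∁ ⁅ i ⁆ ∣ ℕ.+ n       ∎)
  where
  open ℕₚ.≤-Reasoning
  ∣∁⁅i⁆∣≡n : ∣ ∁ ⁅ i ⁆ ∣ ≡ n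
  ∣∁⁅i⁆∣≡n = ≡.trans (∣∁p∣≡n∸∣p∣ ⁅ i ⁆) (≡.cong (suc n ∸_) (∣⁅x⁆∣≡1 i))

-- A matching with defect d asks for exactly n - d indices, whereas Rado's selection may produce
-- more.
subset-of-size : ∀ {n m} (p : Subset n) → m ≤ ∣ p ∣ → ∃[ q ] (q Subset.⊆ p × ∣ q ∣ ≡ m)
subset-of-size {n} {zero} p _ = Subset.⊥ , ⊥⊆ , ∣⊥∣≡0 n
subset-of-size {m = suc m} (outside ∷ p) m≤ with subset-of-size p m≤
... | q , q⊆p , ∣q∣≡m = outside ∷ q , out⊆ q⊆p , ∣q∣≡m
subset-of-size {m = suc m} (inside ∷ p) (s≤s m≤) with subset-of-size p m≤
... | q , q⊆p , ∣q∣≡m = inside ∷ q , s⊆s q⊆p , ≡.cong suc ∣q∣≡m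

-- Here `q * m` is dim S and the summand `m` bounds dim T; the worst case is `q = n / m`.
multiple-bound : ∀ {m n v} q .{{_ : NonZero m}} → q ℕ.* m ≤ n → m ∸ 1 ∸ n % m ≤ v →
  q ℕ.* m ℕ.+ m ≤ suc (n ℕ.+ v)
multiple-bound {m} {n} {v} q qm≤n defect≤v = begin
  q ℕ.* m ℕ.+ m                             ≡⟨ ≡.cong (q ℕ.* m ℕ.+_) (ℕₚ.suc-pred m) ⟨
  q ℕ.* m ℕ.+ suc (m ∸ 1)                   ≤⟨ ℕₚ.+-mono-≤ (ℕₚ.*-monoˡ-≤ m q≤n/m) (s≤s m-1≤) ⟩
  n / m ℕ.* m ℕ.+ suc (n % m ℕ.+ v)         ≡⟨ ℕₚ.+-suc _ _ ⟩
  suc (n / m ℕ.* m ℕ.+ (n % m ℕ.+ v))       ≡⟨ ≡.cong suc (ℕₚ.+-assoc (n / m ℕ.* m) (n % m) v) ⟨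
  suc (n / m ℕ.* m ℕ.+ n % m ℕ.+ v)         ≡⟨ ≡.cong (λ r → suc (r ℕ.+ v)) (ℕₚ.+-comm _ (n % m)) ⟩
  suc (n % m ℕ.+ n / m ℕ.* m ℕ.+ v)         ≡⟨ ≡.cong (λ r → suc (r ℕ.+ v)) (m≡m%n+[m/n]*n n m) ⟨
  suc (n ℕ.+ v)                             ∎
  where
  open ℕₚ.≤-Reasoning
  m-1≤ : m ∸ 1 ≤ n % m ℕ.+ v
  m-1≤ = ≤-trans (ℕₚ.m≤n+m∸n (m ∸ 1) (n % m)) (ℕₚ.+-monoʳ-≤ (n % m) defect≤v)
  q≤n/m : q ≤ n / m
  q≤n/m = ≡.subst (_≤ n / m) (m*n/n≡m q m) (/-monoˡ-≤ m qm≤n)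

defect-bound : ∀ {m n e} .{{_ : NonZero m}} → n / m ℕ.* m ℕ.+ (m ∸ 1) ≤ n ℕ.+ e →
  m ∸ 1 ∸ n % m ≤ e
defect-bound {m} {n} {e} ≤n+e = ℕₚ.m≤n+o⇒m∸n≤o (m ∸ 1) (n % m)
  (ℕₚ.+-cancelˡ-≤ (n / m ℕ.* m) _ _ (begin
    n / m ℕ.* m ℕ.+ (m ∸ 1)               ≤⟨ ≤n+e ⟩
    n ℕ.+ e                               ≡⟨ ≡.cong (ℕ._+ e) (m≡m%n+[m/n]*n n m) ⟩
    n % m ℕ.+ n / m ℕ.* m ℕ.+ e           ≡⟨ ≡.cong (ℕ._+ e) (ℕₚ.+-comm (n % m) _) ⟩
    n / m ℕ.* m ℕ.+ n % m ℕ.+ e           ≡⟨ ℕₚ.+-assoc _ (n % m) e ⟩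
    n / m ℕ.* m ℕ.+ (n % m ℕ.+ e)         ∎))
  where open ℕₚ.≤-Reasoning

-- To be read with `j` = dim S = |J|, `p` = |P|, `r` = |J ∩ P| and `q` = dim V: at least `j - e`
-- indices of J are matched.
overlap-bound : ∀ {n e j p q r} → p ≡ n ∸ e → e ≤ n → j ℕ.+ p ≤ n ℕ.+ r → q ℕ.+ r ≤ n →
  j ℕ.+ q ≤ n ℕ.+ e
overlap-bound {n} {e} {j} {p} {q} {r} p≡ e≤n j+p≤n+r q+r≤n = ℕₚ.+-cancelʳ-≤ n _ _ (begin
  j ℕ.+ q ℕ.+ n               ≡⟨ ≡.cong (j ℕ.+ q ℕ.+_) n≡p+e ⟩
  j ℕ.+ q ℕ.+ (p ℕ.+ e)       ≡⟨ solve 4 (λ j q p e → j :+ q :+ (p :+ e) := j :+ p :+ (q :+ e)) ≡.refl j q p e ⟩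
  j ℕ.+ p ℕ.+ (q ℕ.+ e)       ≤⟨ ℕₚ.+-monoˡ-≤ (q ℕ.+ e) j+p≤n+r ⟩
  n ℕ.+ r ℕ.+ (q ℕ.+ e)       ≡⟨ solve 4 (λ n r q e → n :+ r :+ (q :+ e) := n :+ e :+ (q :+ r)) ≡.refl n r q e ⟩
  n ℕ.+ e ℕ.+ (q ℕ.+ r)       ≤⟨ ℕₚ.+-monoʳ-≤ (n ℕ.+ e) q+r≤n ⟩
  n ℕ.+ e ℕ.+ n               ∎)
  where
  open ℕₚ.≤-Reasoning
  open +-*-Solver
  n≡p+e : n ≡ p ℕ.+ e
  n≡p+e = ≡.trans (≡.sym (ℕₚ.m∸n+n≡m e≤n)) (≡.cong (ℕ._+ e) (≡.sym p≡))

module ClassicalExtension {c ℓ₁ ℓ₂} (em : ExcludedMiddle (lsuc (c ⊔ ℓ₁ ⊔ ℓ₂)))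
  (L : HeytingField c ℓ₁ ℓ₂) (K : Subfield L) where

  open FieldExtension L K
  open HeytingField L using (_#_; #-irrefl; #⇒invertible; invertible⇒#; tight; heytingCommutativeRing)
  open HeytingCommutativeRing heytingCommutativeRing using (commutativeRing)
  open CommutativeRing commutativeRing hiding (zero)
  open RingProperties ring using (-1*x≈-x; -0#≈0#; -‿distribˡ-*; -‿+-comm; -‿involutive)
    renaming (x∙y⁻¹≈ε⇒x≈y to x-y≈0⇒x≈y)
  open CommutativeSemigroupProperties +-commutativeSemigroup using (interchange)
  open CommutativeSemigroupProperties *-commutativeSemigroup using ()
    renaming (x∙yz≈y∙xz to x*yz≈y*xz; xy∙z≈xz∙y to xy*z≈xz*y)
  open SetoidReasoning setoid using (begin_; step-≈-⟩; step-≈-⟨; _∎)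
  open Subspace
  module F = Subfield
  module K = Subfield K

  private
    variable
      n m p q a b : ℕ
      x y z : Carrier

  -- Excluded middle is assumed at one level large enough for membership, apartness and statements
  -- quantifying over subspaces; `Lift` brings it to each of them.
  dec : (P : Set (c ⊔ ℓ₁)) → Dec P
  dec P = map′ lower lift (em {Lift (lsuc (c ⊔ ℓ₁ ⊔ ℓ₂)) P})

  dec₁ : (P : Set (lsuc (c ⊔ ℓ₁))) → Dec P
  dec₁ P = map′ lower lift (em {Lift (lsuc (c ⊔ ℓ₁ ⊔ ℓ₂)) P})

  ⊆-or-witness : (P Q : Pred Carrier (c ⊔ ℓ₁)) → P ⊆ Q ⊎ (∃[ x ] (x ∈ P × x ∉ Q))
  ⊆-or-witness P Q with dec (∃[ x ] (x ∈ P × x ∉ Q))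
  ... | yes w = inj₂ w
  ... | no ¬w = inj₁ λ {x} x∈P → stable λ x∉Q → ¬w (x , x∈P , x∉Q)
    where
    stable : {P : Set (c ⊔ ℓ₁)} → ¬ ¬ P → P
    stable {P} ¬¬P with dec P
    ... | yes holds = holds
    ... | no ¬P = contradiction ¬P ¬¬P

  x-0≈x : ∀ x → x - 0# ≈ x
  x-0≈x x = trans (+-congˡ -0#≈0#) (+-identityʳ x)

  -- Nontriviality comes from the apartness: 1 - 0 is invertible, so 1 # 0, and # is irreflexive.
  1≉0 : ¬ (1# ≈ 0#)
  1≉0 1≈0 = #-irrefl 1≈0 (invertible⇒# (1# , eq , trans (*-comm _ _) eq))
    where
    eq : 1# * (1# - 0#) ≈ 1#
    eq = trans (*-identityˡ _) (x-0≈x 1#)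

  zero-or-unit : ∀ x → x ≈ 0# ⊎ (∃[ y ] (y * x ≈ 1#))
  zero-or-unit x with map′ lower lift (em {Lift (lsuc (c ⊔ ℓ₁ ⊔ ℓ₂)) (x # 0#)})
  ... | no ¬x#0 = inj₁ (proj₁ (tight x 0#) ¬x#0)
  ... | yes x#0 with #⇒invertible x#0
  ...   | y , y[x-0]≈1 , _ = inj₂ (y , trans (*-congˡ (sym (x-0≈x x))) y[x-0]≈1)

  cancel-unit : ∀ {y k} → y * k ≈ 1# → ∀ x → y * (k * x) ≈ x
  cancel-unit {y} {k} yk≈1 x =
    trans (sym (*-assoc y k x)) (trans (*-congʳ yk≈1) (*-identityˡ x))

  -- The lattice of subspaces

  infix 4 _∈ᵥ_ _∉ᵥ_ _⊑_ _⋖_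
  infixr 6 _⊕_
  infixr 7 _⊓_

  _∈ᵥ_ _∉ᵥ_ : Carrier → Subspace → Set (c ⊔ ℓ₁)
  x ∈ᵥ X = x ∈ vectors X
  x ∉ᵥ X = ¬ (x ∈ᵥ X)

  _⊑_ : Subspace → Subspace → Set (c ⊔ ℓ₁)
  X ⊑ Y = vectors X ⊆ vectors Y

  -1∈K : - 1# ∈ Scalar
  -1∈K = K.-‿closed K.1-closed

  -‿closed : ∀ W → x ∈ᵥ W → - x ∈ᵥ W
  -‿closed W x∈W = resp-≈ W (-1*x≈-x _) (*-closed W -1∈K x∈W)

  ∈-cancelˡ : ∀ W → z ≈ x + y → z ∈ᵥ W → x ∈ᵥ W → y ∈ᵥ W
  ∈-cancelˡ {z} {x} {y} W z≈x+y z∈W x∈W =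
    resp-≈ W eq (+-closed W (-‿closed W x∈W) z∈W)
    where
    eq : - x + z ≈ y
    eq = begin
      - x + z       ≈⟨ +-congˡ z≈x+y ⟩
      - x + (x + y) ≈⟨ +-assoc _ _ _ ⟨
      - x + x + y   ≈⟨ +-congʳ (-‿inverseˡ x) ⟩
      0# + y        ≈⟨ +-identityˡ y ⟩
      y             ∎

  ∈-cancelʳ : ∀ W → z ≈ x + y → z ∈ᵥ W → y ∈ᵥ W → x ∈ᵥ W
  ∈-cancelʳ W z≈x+y = ∈-cancelˡ W (trans z≈x+y (+-comm _ _))

  -- A nonzero `k` could be divided out. This is the usual way below to see that a coefficient
  -- vanishes.
  scaled-∉ : ∀ W {k} → k ∈ Scalar → x ∉ᵥ W → k * x ∈ᵥ W → k ≈ 0#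
  scaled-∉ W {k} k∈K x∉W kx∈W with zero-or-unit k
  ... | inj₁ k≈0 = k≈0
  ... | inj₂ (l , lk≈1) = contradiction
    (resp-≈ W (cancel-unit lk≈1 _) (*-closed W (K.⁻¹-closed k∈K lk≈1) kx∈W)) x∉W

  zero-scaled : ∀ W {k} → k ≈ 0# → k * x ∈ᵥ W
  zero-scaled W k≈0 = resp-≈ W (sym (trans (*-congʳ k≈0) (zeroˡ _))) (0-closed W)

  𝟎 : Subspace
  𝟎 = record
    { vectors  = λ x → Lift (c ⊔ ℓ₁) (x ≈ 0#)
    ; resp-≈   = λ x≈y (lift x≈0) → lift (trans (sym x≈y) x≈0)
    ; 0-closed = lift refl
    ; +-closed = λ (lift x≈0) (lift y≈0) → lift (trans (+-cong x≈0 y≈0) (+-identityˡ 0#))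
    ; *-closed = λ _ (lift x≈0) → lift (trans (*-congˡ x≈0) (zeroʳ _))
    }

  𝟎-⊑ : ∀ X → 𝟎 ⊑ X
  𝟎-⊑ X (lift x≈0) = resp-≈ X (sym x≈0) (0-closed X)

  full : Subspace
  full = record
    { vectors  = λ _ → Unit
    ; resp-≈   = λ _ _ → tt
    ; 0-closed = tt
    ; +-closed = λ _ _ → tt
    ; *-closed = λ _ _ → tt
    }

  _⊓_ : Subspace → Subspace → Subspace
  X ⊓ Y = record
    { vectors  = λ x → x ∈ᵥ X × x ∈ᵥ Y
    ; resp-≈   = λ x≈y (x∈X , x∈Y) → resp-≈ X x≈y x∈X , resp-≈ Y x≈y x∈Y
    ; 0-closed = 0-closed X , 0-closed Y
    ; +-closed = λ (x∈X , x∈Y) (y∈X , y∈Y) → +-closed X x∈X y∈X , +-closed Y x∈Y y∈Y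
    ; *-closed = λ k∈K (x∈X , x∈Y) → *-closed X k∈K x∈X , *-closed Y k∈K x∈Y
    }

  _⊕_ : Subspace → Subspace → Subspace
  X ⊕ Y = record
    { vectors  = λ z → ∃[ x ] ∃[ y ] (x ∈ᵥ X × y ∈ᵥ Y × z ≈ x + y)
    ; resp-≈   = λ z≈z′ (x , y , x∈X , y∈Y , z≈x+y) →
        x , y , x∈X , y∈Y , trans (sym z≈z′) z≈x+y
    ; 0-closed = 0# , 0# , 0-closed X , 0-closed Y , sym (+-identityˡ 0#)
    ; +-closed = λ (x , y , x∈X , y∈Y , z≈x+y) (x′ , y′ , x′∈X , y′∈Y , z′≈x′+y′) →
        x + x′ , y + y′ , +-closed X x∈X x′∈X , +-closed Y y∈Y y′∈Y ,
        trans (+-cong z≈x+y z′≈x′+y′) (interchange x y x′ y′)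
    ; *-closed = λ {k} k∈K (x , y , x∈X , y∈Y , z≈x+y) →
        k * x , k * y , *-closed X k∈K x∈X , *-closed Y k∈K y∈Y ,
        trans (*-congˡ z≈x+y) (distribˡ k x y)
    }

  ⊑-⊕ˡ : ∀ X Y → X ⊑ X ⊕ Y
  ⊑-⊕ˡ X Y x∈X = _ , 0# , x∈X , 0-closed Y , sym (+-identityʳ _)

  ⊑-⊕ʳ : ∀ X Y → Y ⊑ X ⊕ Y
  ⊑-⊕ʳ X Y y∈Y = 0# , _ , 0-closed X , y∈Y , sym (+-identityˡ _)

  ⊕-⊑ : ∀ {X Y} W → X ⊑ W → Y ⊑ W → X ⊕ Y ⊑ W
  ⊕-⊑ W X⊑W Y⊑W (x , y , x∈X , y∈Y , z≈x+y) =
    resp-≈ W (sym z≈x+y) (+-closed W (X⊑W x∈X) (Y⊑W y∈Y))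

  Line : Carrier → Subspace
  Line w = record
    { vectors  = λ z → ∃[ k ] (k ∈ Scalar × z ≈ k * w)
    ; resp-≈   = λ z≈z′ (k , k∈K , z≈kw) → k , k∈K , trans (sym z≈z′) z≈kw
    ; 0-closed = 0# , K.0-closed , sym (zeroˡ w)
    ; +-closed = λ (k , k∈K , z≈kw) (k′ , k′∈K , z′≈k′w) →
        k + k′ , K.+-closed k∈K k′∈K , trans (+-cong z≈kw z′≈k′w) (sym (distribʳ w k k′))
    ; *-closed = λ {l} l∈K (k , k∈K , z≈kw) →
        l * k , K.*-closed l∈K k∈K , trans (*-congˡ z≈kw) (sym (*-assoc l k w))
    }

  ∈-Line : ∀ w → w ∈ᵥ Line w
  ∈-Line w = 1# , K.1-closed , sym (*-identityˡ w)

  Line-⊑ : ∀ W → x ∈ᵥ W → Line x ⊑ W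
  Line-⊑ W x∈W (k , k∈K , z≈kx) = resp-≈ W (sym z≈kx) (*-closed W k∈K x∈W)

  infixl 6 _+⟨_⟩

  _+⟨_⟩ : Subspace → Carrier → Subspace
  X +⟨ w ⟩ = X ⊕ Line w

  +⟨⟩-⊑ : ∀ {X} W → X ⊑ W → x ∈ᵥ W → X +⟨ x ⟩ ⊑ W
  +⟨⟩-⊑ {x} {X} W X⊑W x∈W = ⊕-⊑ {X} {Line x} W X⊑W (Line-⊑ W x∈W)

  ∈-+⟨⟩ : ∀ X w → w ∈ᵥ X +⟨ w ⟩
  ∈-+⟨⟩ X w = ⊑-⊕ʳ X (Line w) (∈-Line w)

  -- Exchange, flags and dimension

  exchange : ∀ X → y ∈ᵥ X +⟨ x ⟩ → y ∉ᵥ X → x ∈ᵥ X +⟨ y ⟩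
  exchange {y} {x} X (x₀ , l , x₀∈X , (k , k∈K , l≈kx) , y≈x₀+l) y∉X
    with zero-or-unit k
  ... | inj₁ k≈0 = contradiction
    (resp-≈ X (sym y≈x₀+l) (+-closed X x₀∈X (resp-≈ X (sym l≈kx) (zero-scaled X k≈0)))) y∉X
  ... | inj₂ (k⁻¹ , k⁻¹k≈1) =
    resp-≈ W (cancel-unit k⁻¹k≈1 x) (*-closed W (K.⁻¹-closed k∈K k⁻¹k≈1) kx∈W)
    where
    W = X +⟨ y ⟩
    kx∈W : k * x ∈ᵥ W
    kx∈W = resp-≈ W l≈kx
      (∈-cancelˡ W y≈x₀+l (∈-+⟨⟩ X y) (⊑-⊕ˡ X (Line y) x₀∈X))

  -- Carries an explicit generator of Y modulo X, so that a basis can be read off a flag.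
  record _⋖_ (X Y : Subspace) : Set (c ⊔ ℓ₁) where
    constructor cover
    field
      {below} : X ⊑ Y
      {new}   : Carrier
      new∈    : new ∈ᵥ Y
      new∉    : new ∉ᵥ X
      generated : Y ⊑ X +⟨ new ⟩

  ⋖-+⟨⟩ : ∀ X → x ∉ᵥ X → X ⋖ X +⟨ x ⟩
  ⋖-+⟨⟩ {x} X x∉X = cover {below = ⊑-⊕ˡ X (Line x)} (∈-+⟨⟩ X x) x∉X id

  -- The number of covers in a chain from X to Y plays the role of dim Y/X.
  data Flag (X : Subspace) : Subspace → ℕ → Set (lsuc (c ⊔ ℓ₁)) where
    done : ∀ {Y} → X ⊑ Y → Y ⊑ X → Flag X Y 0
    step : ∀ {Y Z} → Flag X Y n → Y ⋖ Z → Flag X Z (suc n)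

  Dim : Subspace → ℕ → Set (lsuc (c ⊔ ℓ₁))
  Dim = Flag 𝟎

  flag-⊑ : ∀ {X Y} → Flag X Y n → X ⊑ Y
  flag-⊑ (done X⊑Y _) x∈X = X⊑Y x∈X
  flag-⊑ (step F Y⋖Z) x∈X = _⋖_.below Y⋖Z (flag-⊑ F x∈X)

  -- Subspaces are predicates, so mutual inclusion stands in for equality and has to be transported
  -- along.
  cover-resp : ∀ {X Y X′ Y′} → X ⊑ X′ → X′ ⊑ X → Y ⊑ Y′ → Y′ ⊑ Y → X ⋖ Y → X′ ⋖ Y′
  cover-resp {X} {Y} {X′} {Y′} X⊑ ⊑X Y⊑ ⊑Y (cover {X⊑Y} {w} w∈ w∉ gen) =
    cover {below = λ x∈ → Y⊑ (X⊑Y (⊑X x∈))} (Y⊑ w∈) (λ w∈X′ → w∉ (⊑X w∈X′))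
      λ y∈ → +⟨⟩-⊑ {X = X} (X′ +⟨ w ⟩) (λ x∈ → ⊑-⊕ˡ X′ (Line w) (X⊑ x∈)) (∈-+⟨⟩ X′ w) (gen (⊑Y y∈))

  flag-resp : ∀ {X Y X′ Y′} → X ⊑ X′ → X′ ⊑ X → Y ⊑ Y′ → Y′ ⊑ Y → Flag X Y n → Flag X′ Y′ n
  flag-resp X⊑ ⊑X Y⊑ ⊑Y (done X⊑Y Y⊑X) =
    done (λ x∈ → Y⊑ (X⊑Y (⊑X x∈))) λ y∈ → X⊑ (Y⊑X (⊑Y y∈))
  flag-resp X⊑ ⊑X Y⊑ ⊑Y (step {Y = Z} F Z⋖Y) =
    step (flag-resp {Y = Z} {Y′ = Z} X⊑ ⊑X id id F)
      (cover-resp {X = Z} {X′ = Z} id id Y⊑ ⊑Y Z⋖Y)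

  dim-resp : ∀ {X Y} → X ⊑ Y → Y ⊑ X → Dim X n → Dim Y n
  dim-resp = flag-resp {X = 𝟎} id id

  flag-++ : ∀ {X Y Z} → Flag X Y p → Flag Y Z q → Flag X Z (q ℕ.+ p)
  flag-++ {X = X} F (done Y⊑Z Z⊑Y) = flag-resp {X = X} id id Y⊑Z Z⊑Y F
  flag-++ F (step G Y⋖Z) = step (flag-++ F G) Y⋖Z

  -- A cover X ⋖ Y survives in exactly one of X ∩ Z ⊆ Y ∩ Z and X + Z ⊆ Y + Z.
  flag-modular : ∀ {X Y} Z → Flag X Y n →
    ∃[ p ] ∃[ q ] (p ℕ.+ q ≡ n × Flag (X ⊓ Z) (Y ⊓ Z) p × Flag (X ⊕ Z) (Y ⊕ Z) q)
  flag-modular {X = X} {Y} Z (done X⊑Y Y⊑X) =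
    0 , 0 , ≡.refl ,
    done (λ (x∈ , z∈) → X⊑Y x∈ , z∈) (λ (y∈ , z∈) → Y⊑X y∈ , z∈) ,
    done (⊕-⊑ {X} {Z} (Y ⊕ Z) (λ x∈ → ⊑-⊕ˡ Y Z (X⊑Y x∈)) (⊑-⊕ʳ Y Z))
         (⊕-⊑ {Y} {Z} (X ⊕ Z) (λ y∈ → ⊑-⊕ˡ X Z (Y⊑X y∈)) (⊑-⊕ʳ X Z))
  flag-modular {X = X} {Y} Z (step {Y = W} F (cover {W⊑Y} {w} w∈Y w∉W gen))
    with flag-modular Z F
  ... | p , q , p+q≡n , F∩ , F+ with dec (w ∈ᵥ W ⊕ Z)
  -- The component `z` differs from `w` by an element of W, so it generates Y modulo W as well and
  -- lies in Z: the cover survives in the intersection.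
  ...   | yes w∈W+Z@(w₀ , z , w₀∈W , z∈Z , w≈w₀+z) =
    suc p , q , ≡.cong suc p+q≡n ,
    step F∩ (cover {below = λ (u∈ , v∈) → W⊑Y u∈ , v∈} (z∈Y , z∈Z) (λ (z∈W , _) → z∉W z∈W) gen∩) ,
    flag-resp id id
      (⊕-⊑ {W} {Z} (Y ⊕ Z) (λ u∈ → ⊑-⊕ˡ Y Z (W⊑Y u∈)) (⊑-⊕ʳ Y Z))
      (⊕-⊑ {Y} {Z} (W ⊕ Z)
        (λ y∈ → +⟨⟩-⊑ {X = W} (W ⊕ Z) (⊑-⊕ˡ W Z) w∈W+Z (gen y∈)) (⊑-⊕ʳ W Z)) F+
    where
    z∈Y : z ∈ᵥ Y
    z∈Y = ∈-cancelˡ Y w≈w₀+z w∈Y (W⊑Y w₀∈W)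
    z∉W : z ∉ᵥ W
    z∉W z∈W = w∉W (resp-≈ W (sym w≈w₀+z) (+-closed W w₀∈W z∈W))
    gen∩ : Y ⊓ Z ⊑ (W ⊓ Z) +⟨ z ⟩
    gen∩ {y} (y∈Y , y∈Z) =
      u , l , (u∈W , ∈-cancelʳ Z y≈u+l y∈Z (Line-⊑ Z z∈Z l∈)) , l∈ , y≈u+l
      where
      decomposition : y ∈ᵥ W +⟨ z ⟩
      decomposition = +⟨⟩-⊑ {X = W} (W +⟨ z ⟩) (⊑-⊕ˡ W (Line z))
        (w₀ , z , w₀∈W , ∈-Line z , w≈w₀+z) (gen y∈Y)
      u = proj₁ decomposition
      l = proj₁ (proj₂ decomposition)
      u∈W = proj₁ (proj₂ (proj₂ decomposition))
      l∈ = proj₁ (proj₂ (proj₂ (proj₂ decomposition)))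
      y≈u+l = proj₂ (proj₂ (proj₂ (proj₂ decomposition)))
  -- An element u + k w of Y ∩ Z would put k w into W + Z, hence k = 0 and Y ∩ Z ⊆ W: the cover
  -- survives in the sum.
  ...   | no w∉W+Z =
    p , suc q , ≡.trans (ℕₚ.+-suc p q) (≡.cong suc p+q≡n) ,
    flag-resp id id (λ (u∈ , v∈) → W⊑Y u∈ , v∈)
      (λ (y∈Y , y∈Z) → Y∩Z⊑W y∈Y y∈Z , y∈Z) F∩ ,
    step F+ (cover {below = ⊕-⊑ {W} {Z} (Y ⊕ Z) (λ u∈ → ⊑-⊕ˡ Y Z (W⊑Y u∈)) (⊑-⊕ʳ Y Z)}
      (⊑-⊕ˡ Y Z w∈Y) w∉W+Z
      (⊕-⊑ {Y} {Z} ((W ⊕ Z) +⟨ w ⟩)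
        (λ y∈ → +⟨⟩-⊑ {X = W} ((W ⊕ Z) +⟨ w ⟩)
          (λ u∈ → ⊑-⊕ˡ (W ⊕ Z) (Line w) (⊑-⊕ˡ W Z u∈)) (∈-+⟨⟩ (W ⊕ Z) w) (gen y∈))
        (λ z∈ → ⊑-⊕ˡ (W ⊕ Z) (Line w) (⊑-⊕ʳ W Z z∈))))
    where
    Y∩Z⊑W : y ∈ᵥ Y → y ∈ᵥ Z → y ∈ᵥ W
    Y∩Z⊑W y∈Y y∈Z with gen y∈Y
    ... | u , l , u∈W , (k , k∈K , l≈kw) , y≈u+l =
      resp-≈ W (sym y≈u+l) (+-closed W u∈W (resp-≈ W (sym l≈kw) (zero-scaled W k≈0)))
      where
      k≈0 : k ≈ 0#
      k≈0 = scaled-∉ (W ⊕ Z) k∈K w∉W+Z (resp-≈ (W ⊕ Z) l≈kw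
        (∈-cancelˡ (W ⊕ Z) y≈u+l (⊑-⊕ʳ W Z y∈Z) (⊑-⊕ˡ W Z u∈W)))

  flag-trivial : ∀ {X Y} → Flag X Y n → Y ⊑ X → n ≡ 0
  flag-trivial (done _ _) _ = ≡.refl
  flag-trivial (step F (cover w∈Z w∉Y _)) Z⊑X = contradiction (flag-⊑ F (Z⊑X w∈Z)) w∉Y

  -- A subspace between the ends of a cover that contains some vector outside X contains `new` by
  -- exchange, hence all of Y.
  cover-length : ∀ {X Y} → X ⋖ Y → Flag X Y n → n ≡ 1
  cover-length (cover w∈ w∉ _) (done _ Y⊑X) = contradiction (Y⊑X w∈) w∉
  cover-length {X = X} {Y} (cover {new = w} w∈ w∉ gen) (step {Y = Z} F (cover {Z⊑Y} v∈Y v∉Z _)) =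
    ≡.cong suc (flag-trivial F Z⊑X)
    where
    Z⊑X : Z ⊑ X
    Z⊑X with ⊆-or-witness (vectors Z) (vectors X)
    ... | inj₁ Z⊆X = Z⊆X
    ... | inj₂ (z , z∈Z , z∉X) = contradiction (Y⊑Z v∈Y) v∉Z
      where
      w∈Z : w ∈ᵥ Z
      w∈Z = +⟨⟩-⊑ {X = X} Z (flag-⊑ F) z∈Z (exchange X (gen (Z⊑Y z∈Z)) z∉X)
      Y⊑Z : Y ⊑ Z
      Y⊑Z y∈Y = +⟨⟩-⊑ {X = X} Z (flag-⊑ F) w∈Z (gen y∈Y)

  -- A Jordan-Hölder argument: the second flag is cut by the last proper member W of the first into
  -- a flag from X to W, covered by induction, and one from W to Y, of length 1.
  flag-unique : ∀ {X Y} → Flag X Y n → Flag X Y m → n ≡ m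
  flag-unique (done _ Y⊑X) G = ≡.sym (flag-trivial G Y⊑X)
  flag-unique {n = suc n} {m} {X} {Y} (step {Y = W} F W⋖Y) G with flag-modular W G
  ... | p , q , p+q≡m , G∩ , G+ =
    ≡.trans (ℕₚ.+-comm 1 n) (≡.trans (≡.cong₂ ℕ._+_ (flag-unique F G∩′) (≡.sym (cover-length W⋖Y G+′))) p+q≡m)
    where
    W⊑Y = _⋖_.below W⋖Y
    X⊑W = flag-⊑ F
    G∩′ : Flag X W p
    G∩′ = flag-resp proj₁ (λ x∈ → x∈ , X⊑W x∈) proj₂ (λ w∈ → W⊑Y w∈ , w∈) G∩
    G+′ : Flag W Y q
    G+′ = flag-resp (⊕-⊑ {X} {W} W X⊑W id) (⊑-⊕ʳ X W) (⊕-⊑ {Y} {W} Y id W⊑Y) (⊑-⊕ˡ Y W) G+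

  dim-below : ∀ {X Y} → X ⊑ Y → Dim Y b →
    ∃[ p ] ∃[ q ] (p ℕ.+ q ≡ b × Dim X p × Flag X Y q)
  dim-below {X = X} {Y} X⊑Y G with flag-modular X G
  ... | p , q , p+q≡b , G∩ , G+ = p , q , p+q≡b ,
    flag-resp proj₁ (λ z∈ → z∈ , 𝟎-⊑ X z∈) proj₂ (λ x∈ → X⊑Y x∈ , x∈) G∩ ,
    flag-resp (⊕-⊑ {𝟎} {X} X (𝟎-⊑ X) id) (⊑-⊕ʳ 𝟎 X) (⊕-⊑ {Y} {X} Y id X⊑Y) (⊑-⊕ˡ Y X) G+

  dim-mono : ∀ {X Y} → X ⊑ Y → Dim X a → Dim Y b → a ≤ b
  dim-mono X⊑Y F G with dim-below X⊑Y G
  ... | p , q , p+q≡b , F′ , _ = ≡.subst₂ _≤_ (flag-unique F′ F) p+q≡b (ℕₚ.m≤m+n p q)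

  dim-≥⇒⊒ : ∀ {X Y} → X ⊑ Y → Dim X a → Dim Y b → b ≤ a → Y ⊑ X
  dim-≥⇒⊒ X⊑Y F G b≤a with dim-below X⊑Y G
  ... | p , _ , _ , _ , done _ Y⊑X = Y⊑X
  ... | p , suc q , p+q≡b , F′ , step _ _ = contradiction
    (ℕₚ.≤-trans (≡.subst (p ℕ.<_) p+q≡b (ℕₚ.m<m+n p (s≤s z≤n)))
      (≡.subst (_ ≤_) (flag-unique F F′) b≤a)) (ℕₚ.n≮n p)

  dim-modular : ∀ {X Y} → Dim X a → Dim Y b →
    ∃[ p ] ∃[ q ] (Dim (X ⊓ Y) p × Dim (X ⊕ Y) q × p ℕ.+ q ≡ a ℕ.+ b)
  dim-modular {a = a} {b} {X} {Y} F G with flag-modular Y F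
  ... | p , q , p+q≡a , F∩ , F+ = p , q ℕ.+ b ,
    flag-resp proj₁ (λ z∈ → z∈ , 𝟎-⊑ Y z∈) id id F∩ ,
    flag-++ G (flag-resp (⊕-⊑ {𝟎} {Y} Y (𝟎-⊑ Y) id) (⊑-⊕ʳ 𝟎 Y) id id F+) ,
    ≡.trans (≡.sym (ℕₚ.+-assoc p q b)) (≡.cong (ℕ._+ b) p+q≡a)

  dim-𝟎 : Dim 𝟎 0
  dim-𝟎 = done id id

  dim-+⟨⟩ : ∀ {X} → Dim X n → x ∉ᵥ X → Dim (X +⟨ x ⟩) (suc n)
  dim-+⟨⟩ {X = X} F x∉X = step F (⋖-+⟨⟩ X x∉X)

  dim-Line : ¬ (x ≈ 0#) → Dim (Line x) 1
  dim-Line {x} x≉0 = dim-resp (⊕-⊑ {𝟎} {Line x} (Line x) (𝟎-⊑ (Line x)) id) (⊑-⊕ʳ 𝟎 (Line x))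
    (dim-+⟨⟩ dim-𝟎 λ (lift x≈0) → x≉0 x≈0)

  -- Bases and coordinates

  -- Adds one line per chosen index, so that independence turns the recursion directly into a flag;
  -- `⟨_⟩` is reached through `Span`.
  spanOn : Subset n → Vector Carrier n → Subspace
  spanOn []            v = 𝟎
  spanOn (inside  ∷ J) v = spanOn J (tail v) +⟨ head v ⟩
  spanOn (outside ∷ J) v = spanOn J (tail v)

  span : Vector Carrier n → Subspace
  span = spanOn ⊤

  spanOn-∋ : ∀ {J : Subset n} {i} v → i Subset.∈ J → v i ∈ᵥ spanOn J v
  spanOn-∋ {J = inside ∷ J} v here = ∈-+⟨⟩ (spanOn J (tail v)) (head v)
  spanOn-∋ {J = inside ∷ J} v (there i∈J) =
    ⊑-⊕ˡ (spanOn J (tail v)) (Line (head v)) (spanOn-∋ (tail v) i∈J)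
  spanOn-∋ {J = outside ∷ J} v (there i∈J) = spanOn-∋ (tail v) i∈J

  spanOn-⊑ : ∀ (J : Subset n) v W → (∀ {i} → i Subset.∈ J → v i ∈ᵥ W) → spanOn J v ⊑ W
  spanOn-⊑ []            v W v∈W = 𝟎-⊑ W
  spanOn-⊑ (inside  ∷ J) v W v∈W =
    +⟨⟩-⊑ {X = spanOn J (tail v)} W (spanOn-⊑ J (tail v) W λ i∈J → v∈W (there i∈J)) (v∈W here)
  spanOn-⊑ (outside ∷ J) v W v∈W = spanOn-⊑ J (tail v) W λ i∈J → v∈W (there i∈J)

  spanOn-coordinates : ∀ (J : Subset n) v → x ∈ᵥ spanOn J v →
    Σ[ k ∈ Vector Carrier n ] (∀ i → k i ∈ Scalar) ×
      (∀ {i} → ¬ (i Subset.∈ J) → k i ≈ 0#) × x ≈ combination k v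
  spanOn-coordinates [] v (lift x≈0) = (λ ()) , (λ ()) , (λ { {()} }) , x≈0
  spanOn-coordinates (inside ∷ J) v (y , l , y∈ , (k₀ , k₀∈K , l≈k₀v₀) , x≈y+l)
    with spanOn-coordinates J (tail v) y∈
  ... | k , k∈K , k≈0 , y≈ = k₀ Vector.∷ k ,
    (λ { zero → k₀∈K ; (suc i) → k∈K i }) ,
    (λ { {zero} 0∉J → contradiction here 0∉J ; {suc i} i∉J → k≈0 λ i∈J → i∉J (there i∈J) }) ,
    trans x≈y+l (trans (+-comm _ _) (+-cong l≈k₀v₀ y≈))
  spanOn-coordinates (outside ∷ J) v x∈ with spanOn-coordinates J (tail v) x∈
  ... | k , k∈K , k≈0 , x≈ = 0# Vector.∷ k ,
    (λ { zero → K.0-closed ; (suc i) → k∈K i }) ,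
    (λ { {zero} _ → refl ; {suc i} i∉J → k≈0 λ i∈J → i∉J (there i∈J) }) ,
    trans x≈ (sym (trans (+-congʳ (zeroˡ _)) (+-identityˡ _)))

  combination-∈ : ∀ W {k v : Vector Carrier n} → (∀ i → k i ∈ Scalar) → (∀ i → v i ∈ᵥ W) →
    combination k v ∈ᵥ W
  combination-∈ {n = zero}  W k∈K v∈W = 0-closed W
  combination-∈ {n = suc n} W k∈K v∈W = +-closed W (*-closed W (k∈K zero) (v∈W zero))
    (combination-∈ W (λ i → k∈K (suc i)) λ i → v∈W (suc i))

  combination-zero : ∀ {k v : Vector Carrier n} → (∀ i → k i ≈ 0#) → combination k v ≈ 0#
  combination-zero {n = zero}  k≈0 = refl
  combination-zero {n = suc n} k≈0 = trans
    (+-cong (trans (*-congʳ (k≈0 zero)) (zeroˡ _)) (combination-zero λ i → k≈0 (suc i)))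
    (+-identityˡ 0#)

  combination-difference : ∀ (k l v : Vector Carrier n) →
    combination (λ i → k i - l i) v ≈ combination k v - combination l v
  combination-difference {n = zero}  k l v = sym (-‿inverseʳ 0#)
  combination-difference {n = suc n} k l v = begin
    (k zero - l zero) * v zero + combination (λ i → k (suc i) - l (suc i)) (tail v)
      ≈⟨ +-cong (trans (distribʳ _ _ _) (+-congˡ (sym (-‿distribˡ-* _ _))))
                (combination-difference (tail k) (tail l) (tail v)) ⟩
    (k zero * v zero - l zero * v zero) + (combination (tail k) (tail v) - combination (tail l) (tail v))
      ≈⟨ interchange _ _ _ _ ⟩
    combination k v + (- (l zero * v zero) - combination (tail l) (tail v))
      ≈⟨ +-congˡ (-‿+-comm _ _) ⟩
    combination k v - combination l v ∎

  coordinates-unique : ∀ (k l v : Vector Carrier n) → LinearlyIndependent v →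
    (∀ i → k i ∈ Scalar) → (∀ i → l i ∈ Scalar) →
    combination k v ≈ combination l v → ∀ i → k i ≈ l i
  coordinates-unique k l v independent k∈K l∈K eq i = x-y≈0⇒x≈y (k i) (l i)
    (independent (λ i → k i - l i) (λ i → K.+-closed (k∈K i) (K.-‿closed (l∈K i)))
      (trans (combination-difference k l v) (trans (+-congʳ eq) (-‿inverseʳ _))) i)

  tail-independent : (v : Vector Carrier (suc n)) →
    LinearlyIndependent v → LinearlyIndependent (tail v)
  tail-independent v independent k k∈K eq i = independent (0# Vector.∷ k)
    (λ { zero → K.0-closed ; (suc i) → k∈K i })
    (trans (+-cong (zeroˡ _) eq) (+-identityˡ 0#)) (suc i)

  head-∉-spanOn : ∀ (v : Vector Carrier (suc n)) J → LinearlyIndependent v →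
    head v ∉ᵥ spanOn J (tail v)
  head-∉-spanOn v J independent v₀∈ with spanOn-coordinates J (tail v) v₀∈
  ... | k , k∈K , _ , v₀≈ = 1≉0 (begin
    1#     ≈⟨ -‿involutive 1# ⟨
    - - 1# ≈⟨ -‿cong -1≈0 ⟩
    - 0#   ≈⟨ -0#≈0# ⟩
    0#     ∎)
    where
    -1≈0 : - 1# ≈ 0#
    -1≈0 = independent (- 1# Vector.∷ k) (λ { zero → -1∈K ; (suc i) → k∈K i })
      (trans (+-cong (-1*x≈-x _) (sym v₀≈)) (-‿inverseˡ _)) zero

  dim-spanOn : ∀ (J : Subset n) v → LinearlyIndependent v → Dim (spanOn J v) ∣ J ∣
  dim-spanOn []            v independent = dim-𝟎
  dim-spanOn (inside  ∷ J) v independent =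
    dim-+⟨⟩ (dim-spanOn J (tail v) (tail-independent v independent)) (head-∉-spanOn v J independent)
  dim-spanOn (outside ∷ J) v independent =
    dim-spanOn J (tail v) (tail-independent v independent)

  independent⇒≉0 : ∀ (v : Vector Carrier n) → LinearlyIndependent v → ∀ i → ¬ (v i ≈ 0#)
  independent⇒≉0 v independent zero v₀≈0 = head-∉-spanOn v ⊤ independent
    (resp-≈ W (sym v₀≈0) (0-closed W))
    where W = span (tail v)
  independent⇒≉0 v independent (suc i) =
    independent⇒≉0 (tail v) (tail-independent v independent) i

  dim-span-≤ : ∀ (v : Vector Carrier n) → Dim (span v) m → m ≤ n
  dim-span-≤ {n = zero} v D = ≤-reflexive (flag-unique D dim-𝟎)
  dim-span-≤ {n = suc n} {m} v D
    with dim-below (⊑-⊕ˡ (span (tail v)) (Line (head v))) D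
  ... | p , q , _ , D′ , _ with dec (head v ∈ᵥ span (tail v))
  ...   | no v₀∉ = ≡.subst (_≤ suc n) (flag-unique (dim-+⟨⟩ D′ v₀∉) D) (s≤s (dim-span-≤ (tail v) D′))
  ...   | yes v₀∈ = ℕₚ.m≤n⇒m≤1+n (≤-trans
    (dim-mono (+⟨⟩-⊑ {X = span (tail v)} (span (tail v)) id v₀∈) D D′) (dim-span-≤ (tail v) D′))

  -- If the head lay in the span of the tail, n - 1 vectors would span dimension n. So its
  -- coefficient vanishes, and the tail again spans the full dimension.
  dim-span⇒independent : ∀ (v : Vector Carrier n) → Dim (span v) n → LinearlyIndependent v
  dim-span⇒independent {n = suc n} v D k k∈K eq
    with dim-below (⊑-⊕ˡ (span (tail v)) (Line (head v))) D
  ... | p , q , _ , D′ , _ = λ { zero → k₀≈0 ; (suc i) → k≈0 i }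
    where
    W = span (tail v)
    v₀∉W : head v ∉ᵥ W
    v₀∉W v₀∈W = ℕₚ.n≮n n (≤-trans
      (dim-mono (+⟨⟩-⊑ {X = W} W id v₀∈W) D D′) (dim-span-≤ (tail v) D′))
    D″ : Dim W n
    D″ = ≡.subst (Dim W) (ℕₚ.suc-injective (flag-unique (dim-+⟨⟩ D′ v₀∉W) D)) D′
    k₀≈0 : head k ≈ 0#
    k₀≈0 = scaled-∉ W (k∈K zero) v₀∉W (∈-cancelʳ W (sym eq) (0-closed W)
      (combination-∈ W (λ i → k∈K (suc i)) λ i → spanOn-∋ (tail v) ∈⊤))
    k≈0 : ∀ i → tail k i ≈ 0#
    k≈0 = dim-span⇒independent (tail v) D″ (tail k) (λ i → k∈K (suc i)) (begin
      combination (tail k) (tail v)                       ≈⟨ +-identityˡ _ ⟨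
      0# + combination (tail k) (tail v)                  ≈⟨ +-congʳ (trans (*-congʳ k₀≈0) (zeroˡ _)) ⟨
      head k * head v + combination (tail k) (tail v)     ≈⟨ eq ⟩
      0#                                                  ∎)

  ⟨⟩-cons : (X : Pred Carrier ℓ₁) → ∀ {k} → k ∈ Scalar → x ∈ X → y ∈ ⟨ X ⟩ →
    z ≈ k * x + y → z ∈ ⟨ X ⟩
  ⟨⟩-cons {x = x} X {k = k₀} k₀∈K x∈X (m , k , v , k∈K , v∈X , y≈) z≈ =
    suc m , k₀ Vector.∷ k , x Vector.∷ v ,
    (λ { zero → k₀∈K ; (suc i) → k∈K i }) , (λ { zero → x∈X ; (suc i) → v∈X i }) ,
    trans z≈ (+-congˡ y≈)

  Span : Pred Carrier ℓ₁ → Subspace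
  Span X = record
    { vectors  = ⟨ X ⟩
    ; resp-≈   = λ x≈y (m , k , v , k∈K , v∈X , x≈) → m , k , v , k∈K , v∈X , trans (sym x≈y) x≈
    ; 0-closed = 0 , (λ ()) , (λ ()) , (λ ()) , (λ ()) , refl
    ; +-closed = λ (m , k , v , k∈K , v∈X , x≈) y∈ → sum-closed m k v k∈K v∈X y∈ (+-congʳ x≈)
    ; *-closed = λ l∈K (m , k , v , k∈K , v∈X , x≈) → scaled m k v k∈K v∈X l∈K (*-congˡ x≈)
    }
    where
    sum-closed : ∀ m (k v : Vector Carrier m) → (∀ i → k i ∈ Scalar) → (∀ i → v i ∈ X) →
      y ∈ ⟨ X ⟩ → z ≈ combination k v + y → z ∈ ⟨ X ⟩
    sum-closed zero k v k∈K v∈X (m , l , w , l∈K , w∈X , y≈) z≈ =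
      m , l , w , l∈K , w∈X , trans z≈ (trans (+-identityˡ _) y≈)
    sum-closed (suc m) k v k∈K v∈X y∈ z≈ = ⟨⟩-cons X (k∈K zero) (v∈X zero)
      (sum-closed m (tail k) (tail v) (λ i → k∈K (suc i)) (λ i → v∈X (suc i)) y∈ refl)
      (trans z≈ (+-assoc _ _ _))
    scaled : ∀ m (k v : Vector Carrier m) → (∀ i → k i ∈ Scalar) → (∀ i → v i ∈ X) →
      y ∈ Scalar → z ≈ y * combination k v → z ∈ ⟨ X ⟩
    scaled zero k v k∈K v∈X y∈K z≈ =
      0 , (λ ()) , (λ ()) , (λ ()) , (λ ()) , trans z≈ (zeroʳ _)
    scaled (suc m) k v k∈K v∈X y∈K z≈ = ⟨⟩-cons X (K.*-closed y∈K (k∈K zero)) (v∈X zero)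
      (scaled m (tail k) (tail v) (λ i → k∈K (suc i)) (λ i → v∈X (suc i)) y∈K refl)
      (trans z≈ (trans (distribˡ _ _ _) (+-congʳ (sym (*-assoc _ _ _)))))

  ⟨⟩-∋ : (X : Pred Carrier ℓ₁) → x ∈ X → x ∈ ⟨ X ⟩
  ⟨⟩-∋ X x∈X = ⟨⟩-cons {y = 0#} X K.1-closed x∈X (0-closed (Span X))
    (sym (trans (+-identityʳ _) (*-identityˡ _)))

  ⟨⟩-⊆ : (X : Pred Carrier ℓ₁) → ∀ W → X ⊆ vectors W → ⟨ X ⟩ ⊆ vectors W
  ⟨⟩-⊆ X W X⊆W (m , k , v , k∈K , v∈X , x≈) =
    resp-≈ W (sym x≈) (combination-∈ W k∈K λ i → X⊆W (v∈X i))

  basis⇒dim : ∀ {W} {v : Vector Carrier n} → IsOrderedBasis (vectors W) v → Dim W n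
  basis⇒dim {n} {W} {v} basis =
    dim-resp (spanOn-⊑ ⊤ v W λ {i} _ → members i)
      (λ w∈W → ⟨⟩-⊆ (Range v) (span v) (λ (i , x≈vᵢ) → resp-≈ (span v) (sym x≈vᵢ) (spanOn-∋ v ∈⊤))
        (spanning w∈W))
      (≡.subst (Dim (span v)) (∣⊤∣≡n n) (dim-spanOn ⊤ v independent))
    where open IsOrderedBasis basis

  spanning⇒basis : ∀ {W} {v : Vector Carrier n} → Dim W n →
    (∀ i → v i ∈ᵥ W) → W ⊑ span v → IsOrderedBasis (vectors W) v
  spanning⇒basis {W = W} {v} D v∈W W⊑ = record
    { members     = v∈W
    ; independent = dim-span⇒independent v (dim-resp W⊑ (spanOn-⊑ ⊤ v W λ {i} _ → v∈W i) D)
    ; spanning    = λ w∈W → spanOn-⊑ ⊤ v (Span (Range v)) (λ {i} _ → ⟨⟩-∋ (Range v) (i , refl)) (W⊑ w∈W)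
    }

  -- The generators of the covers form the basis; J marks those that come from the flag of X.
  flag-basis : ∀ {X Y} → Dim X m → Flag X Y q →
    Σ[ v ∈ Vector Carrier (q ℕ.+ m) ] Σ[ J ∈ Subset (q ℕ.+ m) ]
      ∣ J ∣ ≡ m × (∀ {i} → i Subset.∈ J → v i ∈ᵥ X) × (∀ i → v i ∈ᵥ Y) × Y ⊑ span v
  flag-basis (done _ X⊑𝟎) (done _ Y⊑X) =
    (λ ()) , [] , ≡.refl , (λ { {()} }) , (λ ()) , λ y∈ → X⊑𝟎 (Y⊑X y∈)
  -- No cover above X remains, so the flag of X itself is consumed and every index is marked.
  flag-basis {X = X} {Y} (step {Y = W} D (cover {W⊑X} {w} w∈X _ gen)) (done X⊑Y Y⊑X)
    with flag-basis {X = W} {W} D (done id id)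
  ... | v , J , _ , _ , v∈W , W⊑ =
    w Vector.∷ v , ⊤ , ∣⊤∣≡n _ , (λ {i} _ → members i) , (λ i → X⊑Y (members i)) ,
    λ y∈ → +⟨⟩-⊑ {X = W} (span v +⟨ w ⟩) (λ u∈ → ⊑-⊕ˡ (span v) (Line w) (W⊑ u∈))
      (∈-+⟨⟩ (span v) w) (gen (Y⊑X y∈))
    where
    members : ∀ i → (w Vector.∷ v) i ∈ᵥ X
    members zero    = w∈X
    members (suc i) = W⊑X (v∈W i)
  flag-basis {X = X} {Y} D (step {Y = W} F (cover {W⊑Y} {w} w∈Y _ gen)) with flag-basis D F
  ... | v , J , ∣J∣≡m , v∈X , v∈W , W⊑ =
    w Vector.∷ v , outside ∷ J , ∣J∣≡m , (λ { {suc i} (there i∈J) → v∈X i∈J }) ,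
    (λ { zero → w∈Y ; (suc i) → W⊑Y (v∈W i) }) ,
    λ y∈ → +⟨⟩-⊑ {X = W} (span v +⟨ w ⟩) (λ u∈ → ⊑-⊕ˡ (span v) (Line w) (W⊑ u∈))
      (∈-+⟨⟩ (span v) w) (gen y∈)

  adapted-basis : ∀ {X Y} → X ⊑ Y → Dim X m → Dim Y n →
    Σ[ v ∈ Vector Carrier n ] Σ[ J ∈ Subset n ]
      IsOrderedBasis (vectors Y) v × ∣ J ∣ ≡ m × (∀ {i} → i Subset.∈ J → v i ∈ᵥ X)
  adapted-basis {X = X} {Y} X⊑Y D E with dim-below X⊑Y E
  ... | p , q , _ , _ , F with flag-unique (flag-++ D F) E
  ...   | ≡.refl with flag-basis D F
  ...     | v , J , ∣J∣≡m , v∈X , v∈Y , Y⊑ =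
    v , J , spanning⇒basis E v∈Y Y⊑ , ∣J∣≡m , v∈X

  dim⇒basis : ∀ {X} → Dim X n → HasDimension (vectors X) n
  dim⇒basis D with adapted-basis id D D
  ... | v , _ , basis , _ = v , basis

  -- Rado's theorem

  -- The rank condition is the primal form of Rado's condition: U i is the
  -- common kernel of a space of functionals on B, from which one is to be
  -- selected for each i.
  RankCondition : Subspace → ℕ → Vector Subspace n → Set (lsuc (c ⊔ ℓ₁))
  RankCondition B t U = ∀ J X e → Dim X e → X ⊑ B →
    (∀ {i} → i Subset.∈ J → X ⊑ U i) → e ℕ.+ ∣ J ∣ ≤ t

  Violation : Subspace → ℕ → Vector Subspace n → Set (lsuc (c ⊔ ℓ₁))
  Violation B t U = ∃[ J ] ∃[ X ] ∃[ e ] (Dim X e × X ⊑ B ×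
    (∀ {i} → i Subset.∈ J → X ⊑ U i) × t < e ℕ.+ ∣ J ∣)

  rank-condition-or-violation : ∀ B t (U : Vector Subspace n) →
    RankCondition B t U ⊎ Violation B t U
  rank-condition-or-violation B t U with dec₁ (Violation B t U)
  ... | yes violation = inj₂ violation
  ... | no ¬violation = inj₁ λ J X e D X⊑B X⊑U →
    ℕₚ.≮⇒≥ λ t< → ¬violation (J , X , e , D , X⊑B , X⊑U , t<)

  replace : Vector Subspace n → Fin n → Subspace → Vector Subspace n
  replace U i W = Vector.updateAt U i (λ _ → W)

  replace-elim : ∀ {ℓ} (Q : Fin n → Subspace → Set ℓ) U i W →
    Q i W → (∀ j → j ≢ i → Q j (U j)) → ∀ j → Q j (replace U i W j)
  replace-elim Q U i W qW qU j with j Fin.≟ i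
  ... | yes ≡.refl = ≡.subst (Q i) (≡.sym (updateAt-updates i U)) qW
  ... | no j≢i = ≡.subst (Q j) (≡.sym (updateAt-minimal j i U j≢i)) (qU j j≢i)

  -- X ∩ B has codimension at most one in B: it is the kernel of a single, possibly zero, functional
  -- on B.
  Coatomic : Subspace → Subspace → Set (c ⊔ ℓ₁)
  Coatomic B X = ∀ {x} → x ∈ᵥ B → x ∉ᵥ X → B ⊑ X +⟨ x ⟩

  coatomic-mono : ∀ {B X Y} → X ⊑ Y → Coatomic B X → Coatomic B Y
  coatomic-mono {B} {X} {Y} X⊑Y coatomic {x} x∈B x∉Y y∈B =
    +⟨⟩-⊑ {X = X} (Y +⟨ x ⟩) (λ z∈ → ⊑-⊕ˡ Y (Line x) (X⊑Y z∈)) (∈-+⟨⟩ Y x)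
      (coatomic x∈B (λ x∈X → x∉Y (X⊑Y x∈X)) y∈B)

  coatomic-or-independent-pair : ∀ B X → Coatomic B X ⊎
    (∃[ x ] ∃[ y ] (x ∈ᵥ B × x ∉ᵥ X × y ∈ᵥ B × y ∉ᵥ X +⟨ x ⟩))
  coatomic-or-independent-pair B X
    with dec (∃[ x ] ∃[ y ] (x ∈ᵥ B × x ∉ᵥ X × y ∈ᵥ B × y ∉ᵥ X +⟨ x ⟩))
  ... | yes pair = inj₂ pair
  ... | no ¬pair = inj₁ coatomic
    where
    coatomic : Coatomic B X
    coatomic {x} x∈B x∉X with ⊆-or-witness (vectors B) (vectors (X +⟨ x ⟩))
    ... | inj₁ B⊑ = B⊑
    ... | inj₂ (y , y∈B , y∉) = contradiction (x , y , x∈B , x∉X , y∈B , y∉) ¬pair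

  +⟨⟩-⊓-+⟨⟩ : ∀ X → y ∉ᵥ X +⟨ x ⟩ → (X +⟨ x ⟩) ⊓ (X +⟨ y ⟩) ⊑ X
  +⟨⟩-⊓-+⟨⟩ {y} {x} X y∉ (z∈X+x , (u , l , u∈X , (k , k∈K , l≈ky) , z≈u+l)) =
    resp-≈ X (sym z≈u+l) (+-closed X u∈X (resp-≈ X (sym l≈ky) (zero-scaled X
      (scaled-∉ W k∈K y∉ (resp-≈ W l≈ky (∈-cancelˡ W z≈u+l z∈X+x (⊑-⊕ˡ X (Line x) u∈X)))))))
    where W = X +⟨ x ⟩

  -- Submodularity of the dimension: with W₁ ∩ W₂ ⊆ U i, two violations would
  -- give one of U itself, at J₁ ∪ J₂ or at J₁ ∩ J₂ \ {i}.
  no-two-violations : ∀ {B t} (U : Vector Subspace n) i {W₁ W₂} → RankCondition B t U →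
    W₁ ⊓ W₂ ⊑ U i → Violation B t (replace U i W₁) → ¬ Violation B t (replace U i W₂)
  no-two-violations {n = n} {B = B} {t} U i {W₁} {W₂} rank W₁∩W₂⊑
    (J₁ , X , e , D , X⊑B , X⊑ , t<₁) (J₂ , Y , f , E , Y⊑B , Y⊑ , t<₂)
    with dim-modular D E
  ... | p , q , D∩ , D+ , p+q≡e+f = ℕₚ.n≮n _ (begin-strict
    t ℕ.+ suc t <⟨ ℕₚ.+-mono-<-≤ t<₁ t<₂ ⟩
    (e ℕ.+ ∣ J₁ ∣) ℕ.+ (f ℕ.+ ∣ J₂ ∣)
      ≡⟨ interchangeℕ e _ f _ ⟩
    (e ℕ.+ f) ℕ.+ (∣ J₁ ∣ ℕ.+ ∣ J₂ ∣)
      ≡⟨ ≡.cong₂ ℕ._+_ p+q≡e+f (∣p∪q∣+∣p∩q∣≡∣p∣+∣q∣ J₁ J₂) ⟨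
    (p ℕ.+ q) ℕ.+ (∣ J₁ ∪ J₂ ∣ ℕ.+ ∣ J₁ ∩ J₂ ∣)
      ≡⟨ interchangeℕ p q _ _ ⟩
    (p ℕ.+ ∣ J₁ ∪ J₂ ∣) ℕ.+ (q ℕ.+ ∣ J₁ ∩ J₂ ∣)
      ≤⟨ ℕₚ.+-mono-≤ ∪-bound ∩-bound ⟩
    t ℕ.+ suc t ∎ℕ)
    where
    open ℕₚ.≤-Reasoning using (begin-strict_; step-<; step-≤; step-≡-⟩; step-≡-⟨) renaming (_∎ to _∎ℕ)
    interchangeℕ = CommutativeSemigroupProperties.interchange ℕₚ.+-commutativeSemigroup
    keep : ∀ {J Z W j} → (∀ {j} → j Subset.∈ J → Z ⊑ replace U i W j) →
      j Subset.∈ J → j ≢ i → Z ⊑ U j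
    keep {Z = Z} {W} {j} Z⊑ j∈J j≢i =
      ≡.subst (λ V → Z ⊑ V) (updateAt-minimal j i U j≢i) (Z⊑ j∈J)
    -- A violation that avoids the replaced index would already violate the rank condition of U.
    used : ∀ {J Z W e} → Dim Z e → Z ⊑ B → (∀ {j} → j Subset.∈ J → Z ⊑ replace U i W j) →
      t < e ℕ.+ ∣ J ∣ → Z ⊑ W
    used {J} {Z} {W} {e} D Z⊑B Z⊑ t< with i ∈? J
    ... | yes i∈J = ≡.subst (λ V → Z ⊑ V) (updateAt-updates i U) (Z⊑ i∈J)
    ... | no i∉J = contradiction
      (rank J Z e D Z⊑B λ j∈J → keep {J} {Z} {W} Z⊑ j∈J λ { ≡.refl → i∉J j∈J }) (ℕₚ.<⇒≱ t<)
    ∪-bound : p ℕ.+ ∣ J₁ ∪ J₂ ∣ ≤ t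
    ∪-bound = rank (J₁ ∪ J₂) (X ⊓ Y) p D∩ (λ (x∈ , _) → X⊑B x∈) inclusion
      where
      inclusion : ∀ {j} → j Subset.∈ J₁ ∪ J₂ → X ⊓ Y ⊑ U j
      inclusion {j} j∈ (x∈X , x∈Y) with j Fin.≟ i
      ... | yes ≡.refl = W₁∩W₂⊑
        (used {J₁} {X} {W₁} D X⊑B X⊑ t<₁ x∈X , used {J₂} {Y} {W₂} E Y⊑B Y⊑ t<₂ x∈Y)
      ... | no j≢i with x∈p∪q⁻ J₁ J₂ j∈
      ...   | inj₁ j∈J₁ = keep {J₁} {X} {W₁} X⊑ j∈J₁ j≢i x∈X
      ...   | inj₂ j∈J₂ = keep {J₂} {Y} {W₂} Y⊑ j∈J₂ j≢i x∈Y
    -- X + Y is only known to lie in U j for j other than i; dropping i costs the one unit in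
    -- `suc t`.
    ∩-bound : q ℕ.+ ∣ J₁ ∩ J₂ ∣ ≤ suc t
    ∩-bound = ≤-trans (ℕₚ.+-monoʳ-≤ q (∣p∣≤1+∣p∩∁⁅i⁆∣ (J₁ ∩ J₂) i))
      (≡.subst (_≤ suc t) (≡.sym (ℕₚ.+-suc q _))
        (s≤s (rank ((J₁ ∩ J₂) ∩ ∁ ⁅ i ⁆) (X ⊕ Y) q D+ (⊕-⊑ {X} {Y} B X⊑B Y⊑B) inclusion)))
      where
      inclusion : ∀ {j} → j Subset.∈ (J₁ ∩ J₂) ∩ ∁ ⁅ i ⁆ → X ⊕ Y ⊑ U j
      inclusion {j} j∈ with x∈p∩q⁻ (J₁ ∩ J₂) (∁ ⁅ i ⁆) j∈
      ... | j∈J₁∩J₂ , j∈∁ with x∈p∩q⁻ J₁ J₂ j∈J₁∩J₂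
      ...   | j∈J₁ , j∈J₂ = ⊕-⊑ {X} {Y} (U j)
        (keep {J₁} {X} {W₁} X⊑ j∈J₁ j≢i) (keep {J₂} {Y} {W₂} Y⊑ j∈J₂ j≢i)
        where j≢i = x∉⁅y⁆⇒x≢y (x∈∁p⇒x∉p j∈∁)

  Enlargement : Subspace → ℕ → Vector Subspace n → Vector Subspace n → Set (lsuc (c ⊔ ℓ₁))
  Enlargement B t U V = RankCondition B t V × (∀ j → U j ⊑ V j) × (∀ j → V j ⊑ B)

  -- If U i has codimension at least two, there are x and y independent modulo it. Then U i + x and
  -- U i + y meet in U i, so at most one of them breaks the rank condition. The codimension is at
  -- most `f`, which drops at each enlargement.
  enlarge : ∀ {B t} f (U : Vector Subspace n) i → RankCondition B t U → (∀ j → U j ⊑ B) →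
    Dim B b → Dim (U i) a → b ≤ a ℕ.+ f →
    ∃[ V ] (Enlargement B t U V × Coatomic B (V i))
  enlarge {b = b} {a} {B = B} {t} f U i rank U⊑B DB DU b≤a+f
    with coatomic-or-independent-pair B (U i)
  ... | inj₁ coatomic = U , (rank , (λ _ → id) , U⊑B) , coatomic
  ... | inj₂ (x , y , x∈B , x∉U , y∈B , y∉U+x) = cases f b≤a+f
    where
    y∉U : y ∉ᵥ U i
    y∉U y∈U = y∉U+x (⊑-⊕ˡ (U i) (Line x) y∈U)
    recurse : ∀ f {w} → b ≤ a ℕ.+ suc f → w ∈ᵥ B → w ∉ᵥ U i →
      RankCondition B t (replace U i (U i +⟨ w ⟩)) →
      ∃[ V ] (Enlargement B t U V × Coatomic B (V i))
    recurse f {w} b≤ w∈B w∉U rank′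
      with enlarge f (replace U i W) i rank′
        (replace-elim (λ _ V → V ⊑ B) U i W (+⟨⟩-⊑ {X = U i} B (U⊑B i) w∈B) λ j _ → U⊑B j)
        DB (≡.subst (λ V → Dim V (suc a)) (≡.sym (updateAt-updates i U)) (dim-+⟨⟩ DU w∉U))
        (≡.subst (b ≤_) (ℕₚ.+-suc a f) b≤)
      where W = U i +⟨ w ⟩
    ... | V , (rankV , replaced⊑V , V⊑B) , coatomic =
      V , (rankV , (λ j u∈ → replaced⊑V j (U⊑replaced j u∈)) , V⊑B) , coatomic
      where
      U⊑replaced : ∀ j → U j ⊑ replace U i (U i +⟨ w ⟩) j
      U⊑replaced = replace-elim (λ j V → U j ⊑ V) U i (U i +⟨ w ⟩) (⊑-⊕ˡ (U i) (Line w)) λ _ _ → id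
    cases : ∀ f → b ≤ a ℕ.+ f → ∃[ V ] (Enlargement B t U V × Coatomic B (V i))
    cases zero b≤a+0 = contradiction
      (≤-trans (dim-mono (+⟨⟩-⊑ {X = U i} B (U⊑B i) x∈B) (dim-+⟨⟩ DU x∉U) DB)
        (≡.subst (b ≤_) (ℕₚ.+-identityʳ a) b≤a+0)) (ℕₚ.n≮n a)
    cases (suc f) b≤ with rank-condition-or-violation B t (replace U i (U i +⟨ x ⟩))
    ... | inj₁ rank₁ = recurse f b≤ x∈B x∉U rank₁
    ... | inj₂ violation₁ with rank-condition-or-violation B t (replace U i (U i +⟨ y ⟩))
    ...   | inj₁ rank₂ = recurse f b≤ y∈B y∉U rank₂
    ...   | inj₂ violation₂ = contradiction violation₂
      (no-two-violations {B = B} U i {U i +⟨ x ⟩} {U i +⟨ y ⟩} rank (+⟨⟩-⊓-+⟨⟩ (U i) y∉U+x) violation₁)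

  -- The indices are treated one at a time; later enlargements do no harm, as a subspace containing
  -- a coatomic one is coatomic.
  enlarge-all : ∀ {B t} k (f : Fin k → Fin n) (U : Vector Subspace n) →
    RankCondition B t U → (∀ j → U j ⊑ B) → Dim B b →
    ∃[ V ] (Enlargement B t U V × (∀ i → Coatomic B (V (f i))))
  enlarge-all zero f U rank U⊑B DB = U , (rank , (λ _ → id) , U⊑B) , λ ()
  enlarge-all {b = b} {B = B} {t} (suc k) f U rank U⊑B DB
    with enlarge-all k (tail f) U rank U⊑B DB
  ... | V , (rankV , U⊑V , V⊑B) , coatomicV with dim-below (V⊑B (f zero)) DB
  ...   | a , _ , _ , DV , _ with enlarge b V (f zero) rankV V⊑B DB DV (ℕₚ.m≤n+m b a)
  ...     | W , (rankW , V⊑W , W⊑B) , coatomicW =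
    W , (rankW , (λ j u∈ → V⊑W j (U⊑V j u∈)) , W⊑B) ,
    λ { zero → coatomicW
      ; (suc i) → coatomic-mono {B} {V (f (suc i))} {W (f (suc i))} (V⊑W (f (suc i))) (coatomicV i) }

  -- Vectors e i (i ∈ P) dual to the functionals with kernels U i, together with
  -- a complement Z of their span on which all the functionals vanish.
  record Dualisation (B : Subspace) (b : ℕ) (U : Vector Subspace n) : Set (lsuc (c ⊔ ℓ₁)) where
    field
      P          : Subset n
      e          : Vector Carrier n
      Z          : Subspace
      {dim}      : ℕ
      dim-Z      : Dim Z dim
      size       : dim ℕ.+ ∣ P ∣ ≡ b
      Z⊑B        : Z ⊑ B
      Z⊑U        : ∀ i → Z ⊑ U i
      e∈B        : ∀ {i} → i Subset.∈ P → e i ∈ᵥ B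
      diagonal   : ∀ {i} → i Subset.∈ P → e i ∉ᵥ U i
      off-diagonal : ∀ {i j} → i Subset.∈ P → j Subset.∈ P → j ≢ i → e j ∈ᵥ U i
      generating : ∀ W → Z ⊑ W → (∀ {i} → i Subset.∈ P → e i ∈ᵥ W) → B ⊑ W

  -- Gaussian elimination. A functional vanishing on Z is dropped from P. Otherwise some w in Z lies
  -- outside its kernel: w is dual to it, is killed by the other functionals, and serves to correct
  -- the other e i into the new kernel.
  dualise : ∀ {B} (U : Vector Subspace n) → Dim B b → (∀ i → Coatomic B (U i)) → Dualisation B b U
  dualise {n = zero} {b} {B} U DB _ = record
    { P = []
    ; e = λ ()
    ; Z = B
    ; dim-Z = DB
    ; size = ℕₚ.+-identityʳ b
    ; Z⊑B = id
    ; Z⊑U = λ ()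
    ; e∈B = λ { {()} }
    ; diagonal = λ { {()} }
    ; off-diagonal = λ { {()} }
    ; generating = λ W B⊑W _ → B⊑W
    }
  dualise {n = suc n} {b} {B} U DB coatomic
    with dualise (tail U) DB (λ i → coatomic (suc i))
  ... | rest with ⊆-or-witness (vectors (Dualisation.Z rest)) (vectors (U zero))
  ...   | inj₁ Z⊑U₀ = record
    { P = outside ∷ P
    -- A placeholder: this index stays outside P.
    ; e = 0# Vector.∷ e
    ; Z = Z
    ; dim-Z = dim-Z
    ; size = size
    ; Z⊑B = Z⊑B
    ; Z⊑U = λ { zero → Z⊑U₀ ; (suc i) → Z⊑U i }
    ; e∈B = λ { (there i∈P) → e∈B i∈P }
    ; diagonal = λ { (there i∈P) → diagonal i∈P }
    ; off-diagonal = λ { (there i∈P) (there j∈P) j≢i →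
        off-diagonal i∈P j∈P λ j≡i → j≢i (≡.cong suc j≡i) }
    ; generating = λ W Z⊑W e∈W → generating W Z⊑W λ i∈P → e∈W (there i∈P)
    }
    where open Dualisation rest
  ...   | inj₂ (w , w∈Z , w∉U₀) with dim-below {X = Dualisation.Z rest ⊓ U zero} proj₁ (Dualisation.dim-Z rest)
  ...     | p , _ , _ , DZ′ , _ = record
    { P = inside ∷ P
    ; e = w Vector.∷ e′
    ; Z = Z ⊓ U₀
    ; dim-Z = DZ′
    ; size = ≡.trans (ℕₚ.+-suc p ∣ P ∣)
        (≡.trans (≡.cong (ℕ._+ ∣ P ∣) (flag-unique (step DZ′ Z′⋖Z) dim-Z)) size)
    ; Z⊑B = λ (u∈Z , _) → Z⊑B u∈Z
    ; Z⊑U = λ { zero (_ , u∈U₀) → u∈U₀ ; (suc i) (u∈Z , _) → Z⊑U i u∈Z }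
    ; e∈B = λ { here → w∈B ; (there i∈P) → e′-in B i∈P (e∈B i∈P) w∈B }
    ; diagonal = λ { here → w∉U₀ ; {suc i} (there i∈P) e′∈U →
        diagonal i∈P (+⟨⟩-⊑ {X = Line (e′ i)} (tail U i) (Line-⊑ (tail U i) e′∈U) (Z⊑U i w∈Z) (e∈e′+w i∈P)) }
    ; off-diagonal = λ
        { here here 0≢0 → contradiction ≡.refl 0≢0
        ; here (there j∈P) _ → e′∈U₀ j∈P
        ; {suc i} (there _) here _ → Z⊑U i w∈Z
        ; {suc i} (there i∈P) (there j∈P) j≢i → e′-in (tail U i) j∈P
            (off-diagonal i∈P j∈P λ j≡i → j≢i (≡.cong suc j≡i)) (Z⊑U i w∈Z)
        }
    ; generating = λ W Z′⊑W e′∈W → generating W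
        (λ u∈Z → +⟨⟩-⊑ {X = Z ⊓ U₀} W Z′⊑W (e′∈W here) (_⋖_.generated Z′⋖Z u∈Z))
        λ {i} i∈P → +⟨⟩-⊑ {X = Line (e′ i)} W (Line-⊑ W (e′∈W (there i∈P))) (e′∈W here) (e∈e′+w i∈P)
    }
    where
    open Dualisation rest
    U₀ = U zero
    w∈B = Z⊑B w∈Z
    Z′⋖Z : Z ⊓ U₀ ⋖ Z
    Z′⋖Z = cover {below = proj₁} w∈Z (λ (_ , w∈U₀) → w∉U₀ w∈U₀) λ y∈Z →
      let (u , l , u∈U₀ , l∈ , y≈u+l) = coatomic zero w∈B w∉U₀ (Z⊑B y∈Z)
      in u , l , (∈-cancelʳ Z y≈u+l y∈Z (Line-⊑ Z w∈Z l∈) , u∈U₀) , l∈ , y≈u+l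
    -- For i in P this is e i minus the multiple of w that brings it into U₀; elsewhere 0 is a
    -- default.
    corrected : ∀ i → ∃[ u ] (i Subset.∈ P → u ∈ᵥ U₀ × (∃[ l ] (l ∈ᵥ Line w × e i ≈ u + l)))
    corrected i with i ∈? P
    ... | no i∉P = 0# , λ i∈P → contradiction i∈P i∉P
    ... | yes i∈P =
      let (u , l , u∈U₀ , l∈ , eᵢ≈u+l) = coatomic zero w∈B w∉U₀ (e∈B i∈P)
      in u , λ _ → u∈U₀ , l , l∈ , eᵢ≈u+l
    e′ : Vector Carrier n
    e′ i = proj₁ (corrected i)
    e′∈U₀ : ∀ {i} → i Subset.∈ P → e′ i ∈ᵥ U₀
    e′∈U₀ {i} i∈P = proj₁ (proj₂ (corrected i) i∈P)
    e′-in : ∀ W {i} → i Subset.∈ P → e i ∈ᵥ W → w ∈ᵥ W → e′ i ∈ᵥ W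
    e′-in W {i} i∈P eᵢ∈W w∈W with proj₂ (corrected i) i∈P
    ... | _ , l , l∈ , eᵢ≈u+l = ∈-cancelʳ W eᵢ≈u+l eᵢ∈W (Line-⊑ W w∈W l∈)
    e∈e′+w : ∀ {i} → i Subset.∈ P → e i ∈ᵥ Line (e′ i) +⟨ w ⟩
    e∈e′+w {i} i∈P with proj₂ (corrected i) i∈P
    ... | _ , l , l∈ , eᵢ≈u+l = e′ i , l , ∈-Line (e′ i) , l∈ , eᵢ≈u+l

  -- The places outside P receive a basis of Z; their number is exactly dim Z.
  fill : ∀ {Z} (P : Subset n) (x : Vector Carrier n) → Dim Z a → a ℕ.+ ∣ P ∣ ≡ n →
    Σ[ v ∈ Vector Carrier n ] (∀ {i} → i Subset.∈ P → v i ≡ x i) ×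
      (∀ {i} → ¬ (i Subset.∈ P) → v i ∈ᵥ Z) × Z ⊑ span v
  fill [] x (done _ Z⊑𝟎) _ = (λ ()) , (λ { {()} }) , (λ { {()} }) , Z⊑𝟎
  fill (inside ∷ P) x D eq
    with fill P (tail x) D (ℕₚ.suc-injective (≡.trans (≡.sym (ℕₚ.+-suc _ _)) eq))
  ... | v , v≡x , v∈Z , Z⊑ = head x Vector.∷ v ,
    (λ { here → ≡.refl ; (there i∈P) → v≡x i∈P }) ,
    (λ { {zero} 0∉P → contradiction here 0∉P ; {suc i} i∉P → v∈Z λ i∈P → i∉P (there i∈P) }) ,
    λ z∈ → ⊑-⊕ˡ (span v) (Line (head x)) (Z⊑ z∈)
  fill (outside ∷ P) x (done _ _) eq =
    contradiction (≡.subst (_≤ _) eq (∣p∣≤n P)) (ℕₚ.n≮n _)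
  fill {Z = Z} (outside ∷ P) x (step {Y = W} D (cover {W⊑Z} {w} w∈Z _ gen)) eq
    with fill P (tail x) D (ℕₚ.suc-injective eq)
  ... | v , v≡x , v∈W , W⊑ = w Vector.∷ v ,
    (λ { (there i∈P) → v≡x i∈P }) ,
    (λ { {zero} _ → w∈Z ; {suc i} i∉P → W⊑Z (v∈W λ i∈P → i∉P (there i∈P)) }) ,
    λ z∈ → +⟨⟩-⊑ {X = W} (span v +⟨ w ⟩) (λ u∈ → ⊑-⊕ˡ (span v) (Line w) (W⊑ u∈))
      (∈-+⟨⟩ (span v) w) (gen z∈)

  -- Z lies in every enlarged V i, so the rank condition at J = `⊤` gives dim Z ≤ d and leaves at
  -- least n - d dual vectors.
  rado : ∀ {B d} (U : Vector Subspace n) → Dim B n → (∀ i → U i ⊑ B) →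
    RankCondition B (n ℕ.+ d) U →
    Σ[ v ∈ Vector Carrier n ] IsOrderedBasis (vectors B) v ×
      (Σ[ P ∈ Subset n ] ∣ P ∣ ≡ n ∸ d × (∀ {i} → i Subset.∈ P → vectors (U i) ⊆ ⟨ Others v i ⟩))
  rado {n} {B} {d} U DB U⊑B rank with enlarge-all n id U rank U⊑B DB
  ... | V , (rankV , U⊑V , V⊑B) , coatomic = conclusion
    where
    open Dualisation (dualise V DB coatomic)
    dim≤d : dim ≤ d
    dim≤d = ℕₚ.+-cancelˡ-≤ n dim d (≡.subst (_≤ n ℕ.+ d)
      (≡.trans (≡.cong (dim ℕ.+_) (∣⊤∣≡n n)) (ℕₚ.+-comm dim n))
      (rankV ⊤ Z dim dim-Z Z⊑B λ {i} _ → Z⊑U i))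
    n∸d≤∣P∣ : n ∸ d ≤ ∣ P ∣
    n∸d≤∣P∣ = ≤-trans (ℕₚ.∸-monoʳ-≤ n dim≤d)
      (≤-reflexive (≡.trans (≡.cong (_∸ dim) (≡.sym size)) (ℕₚ.m+n∸m≡n dim ∣ P ∣)))
    conclusion : _
    conclusion with subset-of-size P n∸d≤∣P∣ | fill P e dim-Z size
    ... | Q , Q⊆P , ∣Q∣≡n∸d | v , v≡e , v∈Z , Z⊑ =
      v , spanning⇒basis DB v∈B B⊑span , Q , ∣Q∣≡n∸d ,
      λ {i} i∈Q {_} u∈U → others (Q⊆P i∈Q) (U⊑V i u∈U)
      where
      v∈ : ∀ W i → (i Subset.∈ P → e i ∈ᵥ W) → Z ⊑ W → v i ∈ᵥ W
      v∈ W i e∈W Z⊑W with i ∈? P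
      ... | yes i∈P = ≡.subst (λ y → y ∈ᵥ W) (≡.sym (v≡e i∈P)) (e∈W i∈P)
      ... | no i∉P = Z⊑W (v∈Z i∉P)
      v∈B : ∀ i → v i ∈ᵥ B
      v∈B i = v∈ B i e∈B Z⊑B
      B⊑span : B ⊑ span v
      B⊑span = generating (span v) Z⊑ λ {i} i∈P →
        ≡.subst (λ y → y ∈ᵥ span v) (v≡e i∈P) (spanOn-∋ v ∈⊤)
      -- V i contains every v j with j other than i but not v i, so an element of V i has i-th
      -- coefficient zero.
      others : ∀ {i} → i Subset.∈ P → vectors (V i) ⊆ ⟨ Others v i ⟩
      others {i} i∈P {u} u∈V = in-others
        (spanOn-⊑ ⊤ v (O +⟨ v i ⟩) (λ {j} _ → v∈O+vᵢ j) (B⊑span (V⊑B i u∈V)))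
        where
        O = Span (Others v i)
        O⊑V : O ⊑ V i
        O⊑V = ⟨⟩-⊆ (Others v i) (V i) λ (j , j≢i , y≈vⱼ) → resp-≈ (V i) (sym y≈vⱼ)
          (v∈ (V i) j (λ j∈P → off-diagonal i∈P j∈P j≢i) (Z⊑U i))
        v∈O+vᵢ : ∀ j → v j ∈ᵥ O +⟨ v i ⟩
        v∈O+vᵢ j with j Fin.≟ i
        ... | yes ≡.refl = ∈-+⟨⟩ O (v i)
        ... | no j≢i = ⊑-⊕ˡ O (Line (v i)) (⟨⟩-∋ (Others v i) (j , j≢i , refl))
        vᵢ∉V : v i ∉ᵥ V i
        vᵢ∉V vᵢ∈V = diagonal i∈P (≡.subst (λ y → y ∈ᵥ V i) (v≡e i∈P) vᵢ∈V)
        in-others : u ∈ᵥ O +⟨ v i ⟩ → u ∈ ⟨ Others v i ⟩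
        in-others (o , l , o∈O , (k , k∈K , l≈kvᵢ) , u≈o+l) =
          resp-≈ O (sym u≈o+l) (+-closed O o∈O (resp-≈ O (sym l≈kvᵢ) (zero-scaled O k≈0)))
          where
          k≈0 : k ≈ 0#
          k≈0 = scaled-∉ (V i) k∈K vᵢ∉V
            (resp-≈ (V i) l≈kvᵢ (∈-cancelˡ (V i) u≈o+l u∈V (O⊑V o∈O)))

  -- Intermediate fields and their modules

  infixr 7 _·_

  _·_ : Carrier → Subspace → Subspace
  e · X = record
    { vectors  = λ z → ∃[ x ] (x ∈ᵥ X × z ≈ e * x)
    ; resp-≈   = λ z≈z′ (x , x∈X , z≈ex) → x , x∈X , trans (sym z≈z′) z≈ex
    ; 0-closed = 0# , 0-closed X , sym (zeroʳ e)
    ; +-closed = λ (x , x∈X , z≈ex) (y , y∈X , z′≈ey) →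
        x + y , +-closed X x∈X y∈X , trans (+-cong z≈ex z′≈ey) (sym (distribˡ e x y))
    ; *-closed = λ {k} k∈K (x , x∈X , z≈ex) →
        k * x , *-closed X k∈K x∈X , trans (*-congˡ z≈ex) (x*yz≈y*xz k e x)
    }

  flag-· : ∀ {X Y d e} → d * e ≈ 1# → Flag X Y n → Flag (e · X) (e · Y) n
  flag-· de≈1 (done X⊑Y Y⊑X) =
    done (λ (x , x∈X , z≈ex) → x , X⊑Y x∈X , z≈ex) (λ (y , y∈Y , z≈ey) → y , Y⊑X y∈Y , z≈ey)
  flag-· {d = d} {e} de≈1 (step {Y = W} F (cover {W⊑Y} {w} w∈Y w∉W gen)) = step (flag-· de≈1 F)
    (cover {below = λ (x , x∈W , z≈ex) → x , W⊑Y x∈W , z≈ex} (w , w∈Y , refl)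
      (λ (x , x∈W , ew≈ex) → w∉W (resp-≈ W (begin
        x           ≈⟨ cancel-unit de≈1 x ⟨
        d * (e * x) ≈⟨ *-congˡ ew≈ex ⟨
        d * (e * w) ≈⟨ cancel-unit de≈1 w ⟩
        w           ∎) x∈W))
      λ (y , y∈Y , z≈ey) → let (u , l , u∈W , (k , k∈K , l≈kw) , y≈u+l) = gen y∈Y in
        e * u , e * l , (u , u∈W , refl) ,
        (k , k∈K , trans (*-congˡ l≈kw) (x*yz≈y*xz e k w)) ,
        trans z≈ey (trans (*-congˡ y≈u+l) (distribˡ e u l)))

  dim-· : ∀ {X d e} → d * e ≈ 1# → Dim X n → Dim (e · X) n
  dim-· {e = e} de≈1 D = flag-resp (λ (x , lift x≈0 , z≈ex) → lift (trans z≈ex (trans (*-congˡ x≈0) (zeroʳ e))))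
    (𝟎-⊑ (e · 𝟎)) id id (flag-· de≈1 D)

  module Intermediate (F : Subfield L) (K⊆F : Scalar ⊆ Subfield.carrier F) where

    open Subfield F using (carrier)

    subspace : Subspace
    subspace = record
      { vectors  = carrier
      ; resp-≈   = F.resp-≈ F
      ; 0-closed = F.0-closed F
      ; +-closed = F.+-closed F
      ; *-closed = λ k∈K → F.*-closed F (K⊆F k∈K)
      }

    dim-nonZero : Dim subspace m → NonZero m
    dim-nonZero {suc m} _ = _
    dim-nonZero {zero} (done _ F⊑𝟎) = contradiction (lower (F⊑𝟎 (F.1-closed F))) 1≉0

    Stable : Subspace → Set (c ⊔ ℓ₁)
    Stable X = ∀ {h x} → h ∈ carrier → x ∈ᵥ X → h * x ∈ᵥ X

    stable-⊕ : ∀ X x → Stable X → Stable (X ⊕ x · subspace)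
    stable-⊕ X x stable {h} h∈F (u , l , u∈X , (g , g∈F , l≈xg) , y≈u+l) =
      h * u , h * l , stable h∈F u∈X ,
      (h * g , F.*-closed F h∈F g∈F , trans (*-congˡ l≈xg) (x*yz≈y*xz h x g)) ,
      trans (*-congˡ y≈u+l) (distribˡ h u l)

    -- The sum is direct: if x h lay in X with h nonzero in F, stability under the inverse of h
    -- would put x into X.
    dim-⊕ : ∀ X → Stable X → x ∉ᵥ X → Dim X a → Dim subspace m → Dim (X ⊕ x · subspace) (m ℕ.+ a)
    dim-⊕ {x} {a} {m} X stable x∉X D E with zero-or-unit x
    ... | inj₁ x≈0 = contradiction (resp-≈ X (sym x≈0) (0-closed X)) x∉X
    ... | inj₂ (d , dx≈1) with dim-modular D (dim-· dx≈1 E)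
    ...   | p , q , D∩ , D+ , p+q≡a+m = ≡.subst (Dim (X ⊕ x · subspace)) q≡m+a D+
      where
      disjoint : X ⊓ x · subspace ⊑ 𝟎
      disjoint (z∈X , h , h∈F , z≈xh) with zero-or-unit h
      ... | inj₁ h≈0 = lift (trans z≈xh (trans (*-congˡ h≈0) (zeroʳ x)))
      ... | inj₂ (g , gh≈1) = contradiction
        (resp-≈ X (trans (*-congˡ (trans z≈xh (*-comm x h))) (cancel-unit gh≈1 x))
          (stable (F.⁻¹-closed F h∈F gh≈1) z∈X)) x∉X
      q≡m+a : q ≡ m ℕ.+ a
      q≡m+a = ≡.trans (≡.cong (ℕ._+ q) (≡.sym (flag-trivial D∩ disjoint)))
        (≡.trans p+q≡a+m (ℕₚ.+-comm a m))

    module _ (D : Dim subspace m) where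

      -- S is exhausted by copies x F of F, each adding m ≥ 1 to the dimension; `f` bounds what is
      -- still missing.
      multiple-from : ∀ f q {X S} → Stable X → Stable S → X ⊑ S → Dim X (q ℕ.* m) → Dim S a →
        a ≤ f ℕ.+ q ℕ.* m → ∃[ r ] a ≡ r ℕ.* m
      multiple-from f q {X} {S} stableX stableS X⊑S DX DS a≤
        with ⊆-or-witness (vectors S) (vectors X)
      ... | inj₁ S⊑X = q , flag-unique DS (dim-resp X⊑S S⊑X DX)
      multiple-from zero q {X} {S} stableX stableS X⊑S DX DS a≤
          | inj₂ (x , x∈S , x∉X) = contradiction (dim-≥⇒⊒ X⊑S DX DS a≤ x∈S) x∉X
      multiple-from {a = a} (suc f) q {X} {S} stableX stableS X⊑S DX DS a≤
          | inj₂ (x , x∈S , x∉X) = multiple-from f (suc q) (stable-⊕ X x stableX) stableS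
        (⊕-⊑ {X} {x · subspace} S X⊑S λ (h , h∈F , z≈xh) →
          resp-≈ S (sym (trans z≈xh (*-comm x h))) (stableS h∈F x∈S))
        (dim-⊕ X stableX x∉X DX D) DS
        (≤-trans a≤ (≡.subst (_≤ f ℕ.+ (m ℕ.+ q ℕ.* m)) (ℕₚ.+-suc f (q ℕ.* m))
          (ℕₚ.+-monoʳ-≤ f (ℕₚ.+-monoˡ-≤ (q ℕ.* m) (ℕ.>-nonZero⁻¹ m {{dim-nonZero D}})))))

      stable-𝟎 : Stable 𝟎
      stable-𝟎 _ (lift x≈0) = lift (trans (*-congˡ x≈0) (zeroʳ _))

      stable⇒multiple : ∀ {S} → Stable S → Dim S a → ∃[ r ] a ≡ r ℕ.* m
      stable⇒multiple {a} {S} stable DS =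
        multiple-from a 0 stable-𝟎 stable (𝟎-⊑ S) dim-𝟎 DS (ℕₚ.m≤m+n a 0)

  module Stabiliser (S : Subspace) (DS : Dim S a) where

    subfield : Subfield L
    subfield = record
      { carrier   = λ x → ∀ y → y ∈ᵥ S → x * y ∈ᵥ S
      ; resp-≈    = λ x≈x′ x∈ y y∈S → resp-≈ S (*-congʳ x≈x′) (x∈ y y∈S)
      ; 0-closed  = λ y y∈S → zero-scaled S refl
      ; 1-closed  = λ y y∈S → resp-≈ S (sym (*-identityˡ y)) y∈S
      ; +-closed  = λ x∈ x′∈ y y∈S → resp-≈ S (sym (distribʳ y _ _)) (+-closed S (x∈ y y∈S) (x′∈ y y∈S))
      ; -‿closed  = λ x∈ y y∈S → resp-≈ S (-‿distribˡ-* _ y) (-‿closed S (x∈ y y∈S))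
      ; *-closed  = λ x∈ x′∈ y y∈S → resp-≈ S (sym (*-assoc _ _ y)) (x∈ _ (x′∈ y y∈S))
      -- x S lies in S and has the same finite dimension, so x S = S.
      ; ⁻¹-closed = λ {x} {x⁻¹} x∈ x⁻¹x≈1 y y∈S →
          let (z , z∈S , y≈xz) = dim-≥⇒⊒ {X = x · S} {S} (λ (z , z∈S , w≈xz) → resp-≈ S (sym w≈xz) (x∈ z z∈S))
                (dim-· x⁻¹x≈1 DS) DS ≤-refl y∈S
          in resp-≈ S (sym (trans (*-congˡ y≈xz) (cancel-unit x⁻¹x≈1 z))) z∈S
      }

    K⊆stabiliser : Scalar ⊆ Subfield.carrier subfield
    K⊆stabiliser k∈K y y∈S = *-closed S k∈K y∈S

    open Intermediate subfield K⊆stabiliser public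

    -- Multiplication by x embeds the stabiliser into S.
    finite : x ∈ᵥ S → ¬ (x ≈ 0#) → ∃[ m ] (Dim subspace m × m ≤ a)
    finite {x} x∈S x≉0 with zero-or-unit x
    ... | inj₁ x≈0 = contradiction x≈0 x≉0
    ... | inj₂ (d , dx≈1) with dim-below {X = x · subspace} {S}
      (λ (h , h∈ , z≈xh) → resp-≈ S (sym (trans z≈xh (*-comm x h))) (h∈ x x∈S)) DS
    ...   | m , q , m+q≡a , D , _ = m ,
      dim-resp {X = d · (x · subspace)} {subspace}
        (λ (z , (h , h∈ , z≈xh) , y≈dz) → resp-≈ subspace
          (sym (trans y≈dz (trans (*-congˡ z≈xh) (cancel-unit dx≈1 h)))) h∈)
        (λ {h} h∈ → x * h , (h , h∈ , refl) , sym (cancel-unit dx≈1 h))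
        (dim-· (trans (*-comm x d) dx≈1) D) ,
      ≡.subst (m ≤_) m+q≡a (ℕₚ.m≤m+n m q)

  -- The upper bound

  dim-full⇒basis : Dim full n → HasDimension U n
  dim-full⇒basis D with dim⇒basis D
  ... | v , basis = v , record
    { members     = λ _ → _
    ; independent = IsOrderedBasis.independent basis
    ; spanning    = λ _ → IsOrderedBasis.spanning basis tt
    }

  outside-small : ∀ {X} → n <[L:K] → Dim X a → a ≤ n → ∃[ x ] x ∉ᵥ X
  outside-small {X = X} n<[L:K] D a≤n with ⊆-or-witness (vectors full) (vectors X)
  ... | inj₂ (x , _ , x∉X) = x , x∉X
  ... | inj₁ full⊑X = contradiction
    (≤-trans (n<[L:K] (dim-full⇒basis (dim-resp (λ _ → tt) full⊑X D))) a≤n) (ℕₚ.n≮n _)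

  -- The linear Dyson e-transform replaces (S , T) by (S + e T , T ∩ e⁻¹ S). It
  -- keeps dim S + dim T, 1 ∈ T and S T ⊆ A, and lowers dim T unless S T ⊆ S; in
  -- that last case T lies in the stabiliser of S, a field over which S is a
  -- vector space.
  product-bound : ∀ {v A} → n <[L:K] → (∀ {e} → DegreeDefect n e → e ≤ v) → Dim A n →
    ∀ f {S T} → Dim S a → Dim T b → b ≤ f → 1# ∈ᵥ T → x ∈ᵥ S → ¬ (x ≈ 0#) →
    (∀ {y z} → y ∈ᵥ S → z ∈ᵥ T → y * z ∈ᵥ A) → a ℕ.+ b ≤ suc (n ℕ.+ v)
  product-bound {n} {a} {b} {x} {v} {A} n<[L:K] defect≤v DA f {S} {T} DS DT b≤f 1∈T x∈S x≉0 ST⊆A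
    with dec (∃[ e ] ∃[ y ] (e ∈ᵥ S × y ∈ᵥ T × e * y ∉ᵥ S))
  ... | yes (e , y , e∈S , y∈T , ey∉S) with zero-or-unit e
  ...   | inj₁ e≈0 = contradiction (zero-scaled S e≈0) ey∉S
  ...   | inj₂ (d , de≈1) with dim-modular DS (dim-· de≈1 DT)
  ...     | p , q , D∩ , D+ , p+q≡a+b =
    ≡.subst (_≤ suc (n ℕ.+ v)) (≡.trans (ℕₚ.+-comm q p) p+q≡a+b) (transformed f b≤f)
    where
    eT = e · T
    S′ = S ⊕ eT
    T′ = d · (S ⊓ eT)
    -- The product e y lies in e T but not in S, so the new T is strictly smaller.
    p<b : p < b
    p<b = ℕₚ.≰⇒> λ b≤p → ey∉S
      (proj₁ (dim-≥⇒⊒ {X = S ⊓ eT} {eT} proj₂ D∩ (dim-· de≈1 DT) b≤p (y , y∈T , refl)))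
    -- An element t′ of the new T lies in T with e t′ in S; commutativity rewrites (e t) t′ as (e
    -- t′) t, again a product from S and T.
    S′T′⊆A : ∀ {y z} → y ∈ᵥ S′ → z ∈ᵥ T′ → y * z ∈ᵥ A
    S′T′⊆A {y} {z} (u , w , u∈S , (t , t∈T , w≈et) , y≈u+w) (g , (g∈S , t′ , t′∈T , g≈et′) , z≈dg) =
      resp-≈ A (sym (begin
        y * z              ≈⟨ *-cong y≈u+w z≈t′ ⟩
        (u + w) * t′       ≈⟨ distribʳ t′ u w ⟩
        u * t′ + w * t′    ≈⟨ +-congˡ (*-congʳ w≈et) ⟩
        u * t′ + e * t * t′ ≈⟨ +-congˡ (xy*z≈xz*y e t t′) ⟩
        u * t′ + e * t′ * t ≈⟨ +-congˡ (*-congʳ g≈et′) ⟨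
        u * t′ + g * t     ∎))
        (+-closed A (ST⊆A u∈S t′∈T) (ST⊆A g∈S t∈T))
      where
      z≈t′ : z ≈ t′
      z≈t′ = trans z≈dg (trans (*-congˡ g≈et′) (cancel-unit de≈1 t′))
    transformed : ∀ f → b ≤ f → q ℕ.+ p ≤ suc (n ℕ.+ v)
    transformed zero b≤0 = contradiction (≤-trans p<b b≤0) λ ()
    transformed (suc f) b≤ = product-bound n<[L:K] defect≤v DA f D+
      (dim-· (trans (*-comm e d) de≈1) D∩) (ℕ.s≤s⁻¹ (≤-trans p<b b≤))
      -- 1 = d e, and e lies both in S and, as e · 1, in e T.
      (e , (e∈S , 1# , 1∈T , sym (*-identityʳ e)) , sym de≈1)
      (⊑-⊕ˡ S eT x∈S) x≉0 S′T′⊆A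
  product-bound {n} {a} {b} {x} {v} {A} n<[L:K] defect≤v DA f {S} {T} DS DT b≤f 1∈T x∈S x≉0 ST⊆A
    | no ¬escape with Stabiliser.finite S DS x∈S x≉0
  ...   | m , DH , m≤a = bound
    where
    open Stabiliser S DS
    H = Subfield.carrier subfield
    instance
      m≢0 : NonZero m
      m≢0 = dim-nonZero DH
    a≤n : a ≤ n
    a≤n = dim-mono (λ y∈S → resp-≈ A (*-identityʳ _) (ST⊆A y∈S 1∈T)) DS DA
    m≤n = ≤-trans m≤a a≤n
    T⊑H : T ⊑ subspace
    T⊑H {z} z∈T y y∈S with dec (y * z ∈ᵥ S)
    ... | yes yz∈S = resp-≈ S (*-comm y z) yz∈S
    ... | no yz∉S = contradiction (y , z , y∈S , z∈T , yz∉S) ¬escape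
    b≤m : b ≤ m
    b≤m = dim-mono T⊑H DT DH
    bound : a ℕ.+ b ≤ suc (n ℕ.+ v)
    bound with ⊆-or-witness H Scalar
    -- The trivial stabiliser: dim T ≤ 1, and the bound holds whatever `v` is.
    ... | inj₁ H⊆K = ≤-trans (ℕₚ.+-mono-≤ a≤n (dim-mono T⊑K DT (dim-Line 1≉0)))
      (≡.subst (_≤ suc (n ℕ.+ v)) (ℕₚ.+-comm 1 n) (s≤s (ℕₚ.m≤m+n n v)))
      where
      T⊑K : T ⊑ Line 1#
      T⊑K {z} z∈T = z , H⊆K (T⊑H z∈T) , sym (*-identityʳ z)
    ... | inj₂ (h , h∈H , h∉K) with stable⇒multiple DH (λ h∈H y∈S → h∈H _ y∈S) DS
    ...   | q , a≡qm = ≤-trans (ℕₚ.+-mono-≤ (≤-reflexive a≡qm) b≤m)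
      (multiple-bound q (≡.subst (_≤ n) a≡qm a≤n)
        (defect≤v (m , (subfield , K⊂H , H⊂U , dim⇒basis {X = subspace} DH) , m≤n , m≢0 , ≡.refl)))
      where
      K⊂H : Scalar ⊂ H
      K⊂H = K⊆stabiliser , λ H⊆K → h∉K (H⊆K h∈H)
      H⊂U : H ⊂ U
      H⊂U = (λ _ → _) , λ U⊆H → let (y , y∉H) = outside-small n<[L:K] DH m≤n in y∉H (U⊆H _)
  -- For nonzero e this is e⁻¹ A, written without an inverse.
  colon : Subspace → Carrier → Subspace
  colon A e = record
    { vectors  = λ x → e * x ∈ᵥ A
    ; resp-≈   = λ x≈y → resp-≈ A (*-congˡ x≈y)
    ; 0-closed = resp-≈ A (sym (zeroʳ e)) (0-closed A)
    ; +-closed = λ ex∈A ey∈A → resp-≈ A (sym (distribˡ e _ _)) (+-closed A ex∈A ey∈A)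
    ; *-closed = λ {k} k∈K ex∈A → resp-≈ A (x*yz≈y*xz k e _) (*-closed A k∈K ex∈A)
    }

  partially-matched : ∀ {v A B} → n <[L:K] → (∀ {e} → DegreeDefect n e → e ≤ v) → v ≤ n →
    Dim A n → Dim B n → 1# ∉ᵥ B → PartiallyMatched n A B v
  partially-matched {n} {v} {A} {B} n<[L:K] defect≤v v≤n DA DB 1∉B a basis =
    let (b , b-basis , P , ∣P∣≡n∸v , inclusion) = rado stabilised DB (λ _ → proj₁) rank
    in b , b-basis , v≤n , P , ∣P∣≡n∸v , λ i i∈P {_} ((d , daᵢ≈1 , y , y∈A , x≈dy) , x∈B) →
      inclusion i∈P (x∈B , resp-≈ A
        (sym (trans (*-congˡ x≈dy) (cancel-unit (trans (*-comm (a i) d) daᵢ≈1) y))) y∈A)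
    where
    open IsOrderedBasis basis using (members; independent)
    stabilised : Vector Subspace n
    stabilised i = B ⊓ colon A (a i)
    rank : RankCondition B (n ℕ.+ v) stabilised
    rank J X e D X⊑B X⊑ with nonempty? J
    -- For empty J the space S is zero and has no stabiliser of finite dimension to argue with; X ⊆
    -- B is enough.
    ... | no ¬nonempty = ≤-trans
      (≤-reflexive (≡.trans (≡.cong (λ J → e ℕ.+ ∣ J ∣) (Empty-unique ¬nonempty))
        (≡.trans (≡.cong (e ℕ.+_) (∣⊥∣≡0 n)) (ℕₚ.+-identityʳ e))))
      (≤-trans (dim-mono X⊑B D DB) (ℕₚ.m≤m+n n v))
    -- Applied to T = X + ⟨1⟩ of dimension `suc e`, since 1 is not in B; the extra one cancels
    -- against the `suc` of the bound.
    ... | yes (i , i∈J) = ℕ.s≤s⁻¹ (≡.subst (_≤ suc (n ℕ.+ v)) (ℕₚ.+-comm ∣ J ∣ (suc e))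
      (product-bound n<[L:K] defect≤v DA (suc e) (dim-spanOn J a independent)
        (dim-+⟨⟩ D λ 1∈X → 1∉B (X⊑B 1∈X)) ≤-refl (∈-+⟨⟩ X 1#)
        (spanOn-∋ a i∈J) (independent⇒≉0 a independent i) products))
      where
      products : ∀ {y z} → y ∈ᵥ spanOn J a → z ∈ᵥ X +⟨ 1# ⟩ → y * z ∈ᵥ A
      products {y} {z} y∈ z∈ = resp-≈ A (*-comm z y)
        (spanOn-⊑ J a (colon A z) (λ {j} j∈J → resp-≈ A (*-comm (a j) z)
          (+⟨⟩-⊑ {X = X} (colon A (a j)) (λ x∈X → proj₂ (X⊑ j∈J x∈X))
            (resp-≈ A (sym (*-identityʳ (a j))) (members j)) z∈)) y∈)

  -- The lower bound: pairs of large defect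

  -- Each new x is taken outside V + ⟨z⟩, so by exchange z stays outside V + ⟨x⟩. Keeping `room`
  -- abstract lets W be F as well as L.
  grow : ∀ f W {V z} → (∀ X e → Dim X e → e ≤ b → ∃[ x ] (x ∈ᵥ W × x ∉ᵥ X)) →
    Dim V a → f ℕ.+ a ≡ b → V ⊑ W → z ∉ᵥ V →
    ∃[ V′ ] (Dim V′ b × V ⊑ V′ × V′ ⊑ W × z ∉ᵥ V′)
  grow zero W {V} room D ≡.refl V⊑W z∉V = V , D , id , V⊑W , z∉V
  grow {b} {a} (suc f) W {V} {z} room D f+a≡b V⊑W z∉V
    with room (V +⟨ z ⟩) (suc a) (dim-+⟨⟩ D z∉V) (≡.subst (suc a ≤_) f+a≡b (s≤s (ℕₚ.m≤n+m a f)))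
  ... | x , x∈W , x∉V+z
    with grow f W {V +⟨ x ⟩} {z} room (dim-+⟨⟩ D λ x∈V → x∉V+z (⊑-⊕ˡ V (Line z) x∈V))
      (≡.trans (ℕₚ.+-suc f a) f+a≡b) (+⟨⟩-⊑ {X = V} W V⊑W x∈W)
      (λ z∈V+x → x∉V+z (exchange V z∈V+x z∉V))
  ...   | V′ , D′ , V+x⊑V′ , V′⊑W , z∉V′ =
    V′ , D′ , (λ y∈V → V+x⊑V′ (⊑-⊕ˡ V (Line x) y∈V)) , V′⊑W , z∉V′

  grow-in-L : ∀ {V} → n <[L:K] → Dim V a → a ≤ n → z ∉ᵥ V →
    ∃[ V′ ] (Dim V′ n × V ⊑ V′ × z ∉ᵥ V′)
  grow-in-L {n} {a} {V = V} n<[L:K] D a≤n z∉V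
    with grow (n ∸ a) full {V} (λ X e D e≤n → let (x , x∉X) = outside-small n<[L:K] D e≤n in x , tt , x∉X)
      D (ℕₚ.m∸n+n≡m a≤n) (λ _ → tt) z∉V
  ... | V′ , D′ , V⊑V′ , _ , z∉V′ = V′ , D′ , V⊑V′ , z∉V′

  module _ (F : Subfield L) (K⊆F : Scalar ⊆ Subfield.carrier F) where

    open Intermediate F K⊆F

    stable-of-dim : n <[L:K] → Dim subspace m → ∀ q → q ℕ.* m ≤ n →
      ∃[ S ] (Stable S × Dim S (q ℕ.* m))
    stable-of-dim n<[L:K] D zero _ = 𝟎 , (λ {h} {x} → stable-𝟎 D {h} {x}) , dim-𝟎
    stable-of-dim {m = m} n<[L:K] D (suc q) m+qm≤n
      with stable-of-dim n<[L:K] D q (≤-trans (ℕₚ.m≤n+m (q ℕ.* m) m) m+qm≤n)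
    ... | S , stable , DS with outside-small n<[L:K] DS (≤-trans (ℕₚ.m≤n+m (q ℕ.* m) m) m+qm≤n)
    ...   | x , x∉S = S ⊕ x · subspace , stable-⊕ S x stable , dim-⊕ S stable x∉S DS D

    hyperplane-avoiding-1 : .{{_ : NonZero m}} → Dim subspace m →
      ∃[ V ] (Dim V (m ∸ 1) × V ⊑ subspace × 1# ∉ᵥ V)
    hyperplane-avoiding-1 {m} D =
      let (V , DV , _ , V⊑F , 1∉V) = grow (m ∸ 1) subspace {𝟎} room dim-𝟎
            (ℕₚ.+-identityʳ _) (𝟎-⊑ subspace) (λ (lift 1≈0) → 1≉0 1≈0)
      in V , DV , V⊑F , 1∉V
      where
      room : ∀ X e → Dim X e → e ≤ m ∸ 1 → ∃[ x ] (x ∈ᵥ subspace × x ∉ᵥ X)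
      room X e DX e≤ with ⊆-or-witness (vectors subspace) (vectors X)
      ... | inj₂ w = w
      ... | inj₁ F⊑X = contradiction
        (≡.subst (_≤ m ∸ 1) (≡.sym (ℕₚ.suc-pred m)) (≤-trans (dim-mono F⊑X D DX) e≤)) (ℕₚ.n≮n _)

  -- V meets the span of the b i with i in Q trivially: such a vector has no coordinates outside Q,
  -- and those in Q vanish because V avoids them.
  common-others-bound : ∀ {V B} (b : Vector Carrier n) → IsOrderedBasis (vectors B) b → V ⊑ B →
    Dim V a → ∀ (Q : Subset n) → (∀ {i} → i Subset.∈ Q → vectors V ⊆ ⟨ Others b i ⟩) →
    a ℕ.+ ∣ Q ∣ ≤ n
  common-others-bound {n} {V = V} {B} b basis V⊑B D Q V⊆others
    with dim-modular D (dim-spanOn Q b (IsOrderedBasis.independent basis))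
  ... | p , q , D∩ , D+ , p+q≡a+∣Q∣ = ≤-trans
    (≤-reflexive (≡.trans (≡.sym p+q≡a+∣Q∣) (≡.cong (ℕ._+ q) (flag-trivial D∩ disjoint))))
    (dim-mono (⊕-⊑ {V} {spanOn Q b} B V⊑B (spanOn-⊑ Q b B λ {i} _ → members i)) D+ (basis⇒dim {W = B} basis))
    where
    open IsOrderedBasis basis
    disjoint : V ⊓ spanOn Q b ⊑ 𝟎
    disjoint {x} (x∈V , x∈span) with spanOn-coordinates Q b x∈span
    ... | k , k∈K , k≈0-off-Q , x≈ = lift (trans x≈ (combination-zero k≈0))
      where
      k≈0 : ∀ i → k i ≈ 0#
      k≈0 i with i ∈? Q
      ... | no i∉Q = k≈0-off-Q i∉Q
      ... | yes i∈Q with spanOn-coordinates (∁ ⁅ i ⁆) b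
        (⟨⟩-⊆ (Others b i) (spanOn (∁ ⁅ i ⁆) b) (λ (j , j≢i , y≈bⱼ) →
          resp-≈ (spanOn (∁ ⁅ i ⁆) b) (sym y≈bⱼ) (spanOn-∋ b (x∉p⇒x∈∁p (x≢y⇒x∉⁅y⁆ j≢i))))
          (V⊆others i∈Q x∈V))
      ...   | l , l∈K , l≈0 , x≈′ = trans
        (coordinates-unique k l b independent k∈K l∈K (trans (sym x≈) x≈′) i)
        (l≈0 (x∈p⇒x∉∁p (x∈⁅x⁆ i)))

  -- For a basis of A adapted to S, each a i in S has V inside a i⁻¹ A ∩ B. Hence V lies in the span
  -- of the other b j for every matched i of this kind, and at most n - dim V such i exist.
  matched⇒product-bound : ∀ {S V A B} → S ⊑ A → V ⊑ B → Dim S p → Dim V q → Dim A n →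
    (∀ {y z} → y ∈ᵥ S → z ∈ᵥ V → y * z ∈ᵥ A) → ∀ e → PartiallyMatched n A B e → p ℕ.+ q ≤ n ℕ.+ e
  matched⇒product-bound {p} {q} {n} {S} {V} {A} {B} S⊑A V⊑B DS DV DA SV⊆A e matched
    with adapted-basis {X = S} {A} S⊑A DS DA
  ... | a , J , a-basis , ≡.refl , a∈S with matched a a-basis
  ...   | b , b-basis , e≤n , P , ∣P∣≡ , inclusion =
    overlap-bound ∣P∣≡ e≤n (∣p∣+∣q∣≤n+∣p∩q∣ J P)
      (common-others-bound {V = V} {B} b b-basis V⊑B DV (J ∩ P) V⊆others)
    where
    V⊆others : ∀ {i} → i Subset.∈ J ∩ P → vectors V ⊆ ⟨ Others b i ⟩
    V⊆others {i} i∈J∩P {x} x∈V with x∈p∩q⁻ J P i∈J∩P | zero-or-unit (a i)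
    ... | _ , _ | inj₁ aᵢ≈0 = contradiction aᵢ≈0 (independent⇒≉0 a (IsOrderedBasis.independent a-basis) i)
    ... | i∈J , i∈P | inj₂ (d , daᵢ≈1) = inclusion i i∈P
      ((d , daᵢ≈1 , a i * x , SV⊆A (a∈S i∈J) x∈V , sym (cancel-unit daᵢ≈1 x)) , V⊑B x∈V)

  -- A contains an F-subspace S of the largest possible dimension, and B a
  -- complement V of K in F, so that S V ⊆ S ⊆ A.
  large-defect : .{{_ : NonZero m}} → n <[L:K] → ℳ m → m ≤ n →
    ∃[ A ] ∃[ B ] (Dim A n × Dim B n × 1# ∉ᵥ B ×
      (∀ e → PartiallyMatched n A B e → m ∸ 1 ∸ n % m ≤ e))
  large-defect {m} {n} n<[L:K] (F , (K⊆F , _) , _ , _ , F-basis) m≤n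
    with basis⇒dim {W = Intermediate.subspace F K⊆F} F-basis
  ... | DF with stable-of-dim F K⊆F n<[L:K] DF (n / m) (m/n*n≤m n m)
               | hyperplane-avoiding-1 F K⊆F DF
  -- `grow-in-L` enlarges a space away from a prescribed vector: any `y` outside S serves for A,
  -- while B has to avoid 1.
  ...   | S , stable , DS | V , DV , V⊑F , 1∉V with outside-small {X = S} n<[L:K] DS (m/n*n≤m n m)
  ...     | y , y∉S with grow-in-L {V = S} n<[L:K] DS (m/n*n≤m n m) y∉S
                       | grow-in-L {V = V} n<[L:K] DV (≤-trans (ℕₚ.m∸n≤m m 1) m≤n) 1∉V
  ...       | A , DA , S⊑A , _ | B , DB , V⊑B , 1∉B = A , B , DA , DB , 1∉B , λ e matched →
    defect-bound (matched⇒product-bound {S = S} {V} {A} {B} S⊑A V⊑B DS DV DA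
      (λ {y} {z} y∈S z∈V → S⊑A (resp-≈ S (*-comm z y) (stable (V⊑F z∈V) y∈S))) e matched)

  -- Assembling the maximum

  bounded⇒maximum : (X : Pred ℕ (lsuc (c ⊔ ℓ₁))) → ∀ {d} → d ∈ X →
    ∀ N → (∀ {e} → e ∈ X → e ≤ N) → ∃[ v ] IsMaximum X v
  bounded⇒maximum X d∈X N X≤N with dec₁ (X N)
  ... | yes N∈X = N , N∈X , X≤N
  bounded⇒maximum X d∈X zero X≤0 | no 0∉X =
    contradiction (≡.subst X (ℕₚ.n≤0⇒n≡0 (X≤0 d∈X)) d∈X) 0∉X
  bounded⇒maximum X d∈X (suc N) X≤N | no N∉X = bounded⇒maximum X d∈X N λ e∈X →
    ℕ.s≤s⁻¹ (ℕₚ.≤∧≢⇒< (X≤N e∈X) λ { ≡.refl → N∉X e∈X })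

  -- The field realising n₀ could be L a priori; n₀ ≤ n < [L : K] rules this out.
  n₀∈ℳ : ∀ {n₀} → IsN₀ n₀ → n₀ ≤ n → n <[L:K] → ℳ n₀
  n₀∈ℳ ((F , K⊂F , F-basis) , _) n₀≤n n<[L:K] = F , K⊂F , F⊂U , F-basis
    where
    open Intermediate F (proj₁ K⊂F)
    F⊂U : Subfield.carrier F ⊂ U
    F⊂U = (λ _ → _) , λ U⊆F →
      let (x , x∉F) = outside-small n<[L:K] (basis⇒dim {W = subspace} (proj₂ F-basis)) n₀≤n in x∉F (U⊆F _)

  -- Needed twice: to bound the search for the maximum, and because a matching with defect d
  -- requires d ≤ n.
  defect≤n : ∀ {d} → DegreeDefect n d → d ≤ n
  defect≤n {n} (m , _ , m≤n , nz , d≡) = ≤-trans (≤-reflexive d≡)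
    (≤-trans (ℕₚ.m∸n≤m (m ∸ 1) (_%_ n m {{nz}})) (≤-trans (ℕₚ.m∸n≤m m 1) m≤n))

  ℳ-nonZero : ℳ m → NonZero m
  ℳ-nonZero (F , (K⊆F , _) , _ , _ , basis) = dim-nonZero (basis⇒dim {W = subspace} basis)
    where open Intermediate F K⊆F

  module _ {v} (n<[L:K] : n <[L:K]) (maximum : IsMaximum (DegreeDefect n) v) where

    all-matched : ∀ A B → Dim A n → Dim B n → 1# ∉ᵥ B → PartiallyMatched n A B v
    all-matched A B = partially-matched {A = A} {B} n<[L:K] (proj₂ maximum) (defect≤n (proj₁ maximum))

    deficiency≤ : ∀ {e} → DeficiencyAttained n e → e ≤ v
    deficiency≤ (A , B , (_ , A-basis) , (_ , B-basis) , 1∉B , _ , minimal) =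
      minimal (all-matched A B (basis⇒dim {W = A} A-basis) (basis⇒dim {W = B} B-basis) 1∉B)

    deficiency-attained : DeficiencyAttained n v
    deficiency-attained with proj₁ maximum
    ... | m , m∈ℳ , m≤n , nz , ≡.refl with large-defect {{nz}} n<[L:K] m∈ℳ m≤n
    ...   | A , B , DA , DB , 1∉B , defect≤ =
      A , B , dim⇒basis {X = A} DA , dim⇒basis {X = B} DB , 1∉B ,
      all-matched A B DA DB 1∉B , λ {e} → defect≤ e

  Δ-formula : ∀ {n₀} → IsN₀ n₀ → n₀ ≤ n → n <[L:K] →
    ∃[ v ] (IsΔ n v × IsMaximum (DegreeDefect n) v)
  Δ-formula {n} {n₀} isN₀ n₀≤n n<[L:K] with n₀∈ℳ isN₀ n₀≤n n<[L:K]
  -- The degree n₀ itself shows that the set of defects is inhabited.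
  ... | n₀∈ with bounded⇒maximum (DegreeDefect n) (n₀ , n₀∈ , n₀≤n , ℳ-nonZero n₀∈ , ≡.refl) n defect≤n
  ...   | v , maximum = v , (deficiency-attained n<[L:K] maximum , deficiency≤ n<[L:K] maximum) , maximum

theorem4p5 : ∀ {c ℓ₁ ℓ₂} → ExcludedMiddle (lsuc (c ⊔ ℓ₁ ⊔ ℓ₂)) →
    (L : HeytingField c ℓ₁ ℓ₂) (K : Subfield L) →
    let open FieldExtension L K in
    ProperExtension →
    (∃[ m ] ℳ m) →
    (n₀ : ℕ) → IsN₀ n₀ →
    (n : ℕ) → n₀ ≤ n → n <[L:K] →
    ∃[ v ] (IsΔ n v × IsMaximum (DegreeDefect n) v)
theorem4p5 em L K _ _ _ isN₀ _ = ClassicalExtension.Δ-formula em L K isN₀
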